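{- Fix an integer $c$ and a real number $\alpha>0$. Then for all sufficiently large $n$ the following holds, with $h=\left\lfloor\frac{n+c}{12e\alpha}\right\rfloor$ and $w=\frac{n+c}{\alpha}$: if $v_1<\cdots<v_n$ are positive real numbers satisfying $v_{i+h}\ge w v_i$ for every $1\le i\le n-h$, then $\mathrm{ML}(v_1,\ldots,v_n)>\frac{\alpha}{n+c}$.
   Context: For a real number $x$, $\Vert x\Vert$ denotes the distance from $x$ to the nearest integer. For positive real numbers $v_1,\ldots,v_n$, the maximum loneliness is $\mathrm{ML}(v_1,\ldots,v_n)=\sup_{t\in\mathbb{R}}\min_{1\le i\le n}\Vert t v_i\Vert$. Here $e$ is the base of the natural logarithm. -}

module Defs where

open import Data.Fin.Base using (Fin; zero; suc)
open import Data.Integer.Base as ℤ using (ℤ; +_; +0; +[1+_]; -[1+_])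
import Data.Integer.DivMod as ℤ
import Data.Integer.Properties as ℤ
open import Data.Nat.Base as ℕ using (ℕ; zero; suc; _!; NonZero)
import Data.Nat.Properties as ℕ
open import Data.Product.Base using (∃-syntax; _×_; _,_)
open import Data.Rational.Base as ℚ using (ℚ; mkℚ; 0ℚ; 1ℚ; ½; ∣_∣; *<*; *≤*)
open import Data.Rational.Literals using (fromℤ)
import Data.Rational.Properties as ℚ
import Data.Rational.Unnormalised.Base as ℚᵘ
import Data.Rational.Unnormalised.Properties as ℚᵘ
open import Data.Rational.Solver using (module +-*-Solver)
open import Data.Sum.Base using (inj₁; inj₂)
open import Function.Base using (_∘_)
open import Relation.Binary.PropositionalEquality using (_≡_; refl; sym; trans; cong; subst; subst₂)
open import Relation.Nullary.Decidable.Core using (yes; no)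
open +-*-Solver using (solve; _:=_; _:+_; _:*_; _:-_; :-_; con)

private
  half : ∀ p → ½ ℚ.* p ℚ.+ ½ ℚ.* p ≡ p
  half = solve 1 (λ p → con ½ :* p :+ con ½ :* p := p) refl

  regroup : ∀ p ε → p ℚ.+ ½ ℚ.* (½ ℚ.* ε) ℚ.+ ½ ℚ.* ε ℚ.+ ½ ℚ.* (½ ℚ.* ε) ≡ p ℚ.+ ε
  regroup = solve 2 (λ p ε → p :+ con ½ :* (con ½ :* ε) :+ con ½ :* ε :+ con ½ :* (con ½ :* ε) := p :+ ε) refl

  p-q+q : ∀ p q → p ℚ.- q ℚ.+ q ≡ p
  p-q+q = solve 2 (λ p q → p :- q :+ q := p) refl

  q+[p-q] : ∀ p q → q ℚ.+ (p ℚ.- q) ≡ p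
  q+[p-q] = solve 2 (λ p q → q :+ (p :- q) := p) refl

  q+ε-q : ∀ q ε → q ℚ.+ ε ℚ.- q ≡ ε
  q+ε-q = solve 2 (λ q ε → q :+ ε :- q := ε) refl

  neg-sub : ∀ p q → ℚ.- (p ℚ.- q) ≡ q ℚ.- p
  neg-sub = solve 2 (λ p q → :- (p :- q) := q :- p) refl

  swap-* : ∀ d i p → d ℚ.* (i ℚ.* p) ≡ (i ℚ.* d) ℚ.* p
  swap-* = solve 3 (λ d i p → d :* (i :* p) := (i :* d) :* p) refl

  *-diff : ∀ a b c d → a ℚ.* (b ℚ.- d) ℚ.+ d ℚ.* (a ℚ.- c) ≡ a ℚ.* b ℚ.- c ℚ.* d
  *-diff = solve 4 (λ a b c d → a :* (b :- d) :+ d :* (a :- c) := a :* b :- c :* d) refl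

  inv-diff : ∀ a b i j → (i ℚ.- j) ℚ.* (a ℚ.* b) ≡ (i ℚ.* a) ℚ.* b ℚ.- (j ℚ.* b) ℚ.* a
  inv-diff = solve 4 (λ a b i j → (i :- j) :* (a :* b) := (i :* a) :* b :- (j :* b) :* a) refl

  one-diff : ∀ a b → 1ℚ ℚ.* b ℚ.- 1ℚ ℚ.* a ≡ b ℚ.- a
  one-diff = solve 2 (λ a b → con 1ℚ :* b :- con 1ℚ :* a := b :- a) refl

  tri : ∀ p q k → (q ℚ.- k) ℚ.+ (p ℚ.- q) ≡ p ℚ.- k
  tri = solve 3 (λ p q k → (q :- k) :+ (p :- q) := p :- k) refl

  half-pos : ∀ {p} → 0ℚ ℚ.< p → 0ℚ ℚ.< ½ ℚ.* p
  half-pos {p} 0<p = subst (ℚ._< ½ ℚ.* p) (ℚ.*-zeroʳ ½) (ℚ.*-monoʳ-<-pos ½ 0<p)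

  *-pos-ℚ : ∀ {p q} → 0ℚ ℚ.< p → 0ℚ ℚ.< q → 0ℚ ℚ.< p ℚ.* q
  *-pos-ℚ {p} {q} 0<p 0<q = subst (ℚ._< p ℚ.* q) (ℚ.*-zeroʳ p)
    (ℚ.*-monoʳ-<-pos p {{ℚ.positive 0<p}} 0<q)

  *-mono-ℚ : ∀ {p q r s} → 0ℚ ℚ.≤ p → 0ℚ ℚ.≤ s → p ℚ.≤ q → r ℚ.≤ s → p ℚ.* r ℚ.≤ q ℚ.* s
  *-mono-ℚ {p} {q} {r} {s} 0≤p 0≤s p≤q r≤s = ℚ.≤-trans
    (ℚ.*-monoˡ-≤-nonNeg p {{ℚ.nonNegative 0≤p}} r≤s)
    (ℚ.*-monoʳ-≤-nonNeg s {{ℚ.nonNegative 0≤s}} p≤q)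

  p≤∣p∣ : ∀ p → p ℚ.≤ ∣ p ∣
  p≤∣p∣ p with ℚ.≤-total 0ℚ p
  ... | inj₁ 0≤p = ℚ.≤-reflexive (sym (ℚ.0≤p⇒∣p∣≡p 0≤p))
  ... | inj₂ p≤0 = ℚ.≤-trans p≤0 (ℚ.0≤∣p∣ p)

  ∣∣-sym : ∀ p q → ∣ p ℚ.- q ∣ ≡ ∣ q ℚ.- p ∣
  ∣∣-sym p q = trans (sym (ℚ.∣-p∣≡∣p∣ (p ℚ.- q)))
    (cong ∣_∣ (neg-sub p q))

  ∣∣<-intro : ∀ p q ε → p ℚ.< q ℚ.+ ε → q ℚ.< p ℚ.+ ε → ∣ p ℚ.- q ∣ ℚ.< ε
  ∣∣<-intro p q ε p<q+ε q<p+ε with ℚ.∣p∣≡p∨∣p∣≡-p (p ℚ.- q)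
  ... | inj₁ eq = subst₂ ℚ._<_ (sym eq)
          (q+ε-q q ε) (ℚ.+-monoˡ-< (ℚ.- q) p<q+ε)
  ... | inj₂ eq = subst₂ ℚ._<_
          (trans (sym (neg-sub p q)) (sym eq))
          (q+ε-q p ε) (ℚ.+-monoˡ-< (ℚ.- p) q<p+ε)

  ∣∣<-elim : ∀ p q {ε} → ∣ p ℚ.- q ∣ ℚ.< ε → p ℚ.< q ℚ.+ ε
  ∣∣<-elim p q {ε} d = subst (ℚ._< q ℚ.+ ε)
    (q+[p-q] p q)
    (ℚ.+-monoʳ-< q (ℚ.≤-<-trans (p≤∣p∣ (p ℚ.- q)) d))

  ∣∣<-elim′ : ∀ p q {ε} → ∣ p ℚ.- q ∣ ℚ.< ε → q ℚ.< p ℚ.+ ε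
  ∣∣<-elim′ p q d = ∣∣<-elim q p (subst (ℚ._< _) (∣∣-sym p q) d)

  ∣a*b∣<½ε : ∀ a b B δ ε → ∣ a ∣ ℚ.≤ B → 0ℚ ℚ.< B → ∣ b ∣ ℚ.< δ → B ℚ.* δ ≡ ½ ℚ.* ε →
            ∣ a ℚ.* b ∣ ℚ.< ½ ℚ.* ε
  ∣a*b∣<½ε a b B δ ε a≤B 0<B b<δ eq = subst₂ ℚ._<_ (sym (ℚ.∣p*q∣≡∣p∣*∣q∣ a b)) eq
    (ℚ.≤-<-trans (ℚ.*-monoʳ-≤-nonNeg ∣ b ∣ {{ℚ.∣-∣-nonNeg b}} a≤B)
                 (ℚ.*-monoʳ-<-pos B {{ℚ.positive 0<B}} b<δ))

invℚ : ℚ → ℚ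
invℚ (mkℚ +0 _ _)           = 0ℚ
invℚ p@(mkℚ +[1+ _ ] _ _)   = ℚ.1/ p
invℚ p@(mkℚ (-[1+ _ ]) _ _) = ℚ.1/ p

invℚ-inverse : ∀ {p} → 0ℚ ℚ.< p → invℚ p ℚ.* p ≡ 1ℚ
invℚ-inverse {mkℚ +0 d c} (*<* (ℤ.+<+ ()))
invℚ-inverse {p@(mkℚ +[1+ _ ] _ _)} _ = ℚ.*-inverseˡ p
invℚ-inverse {p@(mkℚ (-[1+ _ ]) _ _)} _ = ℚ.*-inverseˡ p

invℚ-pos : ∀ {p} → 0ℚ ℚ.< p → 0ℚ ℚ.< invℚ p
invℚ-pos {mkℚ +0 d c} (*<* (ℤ.+<+ ()))
invℚ-pos {p@(mkℚ +[1+ _ ] _ _)} _ = ℚ.positive⁻¹ (ℚ.1/ p) {{ℚ.1/pos⇒pos p}}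
invℚ-pos {p@(mkℚ (-[1+ _ ]) _ _)} (*<* ())

private
  *-near : ∀ a b c d B C ε → 0ℚ ℚ.< B → 0ℚ ℚ.< C → ∣ a ∣ ℚ.≤ B → ∣ d ∣ ℚ.≤ C →
           ∣ a ℚ.- c ∣ ℚ.< invℚ C ℚ.* (½ ℚ.* ε) → ∣ b ℚ.- d ∣ ℚ.< invℚ B ℚ.* (½ ℚ.* ε) →
           ∣ a ℚ.* b ℚ.- c ℚ.* d ∣ ℚ.< ε
  *-near a b c d B C ε 0<B 0<C a≤B d≤C a-c b-d = subst (λ p → ∣ p ∣ ℚ.< ε) (*-diff a b c d)
    (ℚ.≤-<-trans (ℚ.∣p+q∣≤∣p∣+∣q∣ (a ℚ.* (b ℚ.- d)) (d ℚ.* (a ℚ.- c)))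
      (subst (∣ a ℚ.* (b ℚ.- d) ∣ ℚ.+ ∣ d ℚ.* (a ℚ.- c) ∣ ℚ.<_) (half ε)
        (ℚ.+-mono-<
          (∣a*b∣<½ε a (b ℚ.- d) B (invℚ B ℚ.* (½ ℚ.* ε)) ε a≤B 0<B b-d (cancel B 0<B))
          (∣a*b∣<½ε d (a ℚ.- c) C (invℚ C ℚ.* (½ ℚ.* ε)) ε d≤C 0<C a-c (cancel C 0<C)))))
    where
    cancel : ∀ D → 0ℚ ℚ.< D → D ℚ.* (invℚ D ℚ.* (½ ℚ.* ε)) ≡ ½ ℚ.* ε
    cancel D 0<D = trans (swap-* D (invℚ D) (½ ℚ.* ε))
      (trans (cong (ℚ._* (½ ℚ.* ε)) (invℚ-inverse 0<D)) (ℚ.*-identityˡ (½ ℚ.* ε)))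

-- A real is a Cauchy sequence of rationals; the witness N makes this a modulus
-- of convergence.  Reals are compared by _<_ and _≤_ only, never by _≡_.
record ℝ : Set where
  constructor mkℝ
  field
    seq    : ℕ → ℚ
    cauchy : ∀ ε → 0ℚ ℚ.< ε →
             ∃[ N ] ∀ m n → N ℕ.≤ m → N ℕ.≤ n → ∣ seq m ℚ.- seq n ∣ ℚ.< ε

open ℝ public

infix 4 _<_ _≤_

_<_ : ℝ → ℝ → Set
x < y = ∃[ ε ] (0ℚ ℚ.< ε × ∃[ N ] ∀ n → N ℕ.≤ n → seq x n ℚ.+ ε ℚ.≤ seq y n)

_≤_ : ℝ → ℝ → Set
x ≤ y = ∀ ε → 0ℚ ℚ.< ε → ∃[ N ] ∀ n → N ℕ.≤ n → seq x n ℚ.≤ seq y n ℚ.+ ε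

fromℚ : ℚ → ℝ
fromℚ q = mkℝ (λ _ → q) λ ε 0<ε → 0 , λ _ _ _ _ → subst (λ p → ∣ p ∣ ℚ.< ε) (sym (ℚ.+-inverseʳ q)) 0<ε

fromInt : ℤ → ℝ
fromInt k = fromℚ (fromℤ k)

0ℝ : ℝ
0ℝ = fromℚ 0ℚ

fromInt-pos : ∀ {k} → + 0 ℤ.< k → 0ℝ < fromInt k
fromInt-pos {+[1+ k ]} _ = fromℤ +[1+ k ] , ℚ.positive⁻¹ (fromℤ +[1+ k ]) , 0 ,
  λ _ _ → ℚ.≤-reflexive (ℚ.+-identityˡ _)
fromInt-pos {+0} (ℤ.+<+ ())

private
  bound : ∀ x → ∃[ B ] (0ℚ ℚ.< B × ∃[ N ] ∀ n → N ℕ.≤ n → ∣ seq x n ∣ ℚ.≤ B)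
  bound x with cauchy x 1ℚ (ℚ.positive⁻¹ 1ℚ)
  ... | N , near = B ,
      ℚ.<-≤-trans (ℚ.positive⁻¹ 1ℚ)
        (subst (ℚ._≤ B) (ℚ.+-identityʳ 1ℚ) (ℚ.+-monoʳ-≤ 1ℚ (ℚ.0≤∣p∣ (seq x N)))) ,
      N , λ n N≤n → subst (λ p → ∣ p ∣ ℚ.≤ B)
        (p-q+q (seq x n) (seq x N))
        (ℚ.≤-trans (ℚ.∣p+q∣≤∣p∣+∣q∣ (seq x n ℚ.- seq x N) (seq x N))
          (ℚ.+-monoˡ-≤ ∣ seq x N ∣ (ℚ.<⇒≤ (near n N N≤n ℕ.≤-refl))))
    where
    B = 1ℚ ℚ.+ ∣ seq x N ∣

infixl 7 _*_ _⊓_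

_*_ : ℝ → ℝ → ℝ
x * y = mkℝ (λ n → seq x n ℚ.* seq y n) λ ε 0<ε →
  let B , 0<B , N₁ , x≤B = bound x
      C , 0<C , N₂ , y≤C = bound y
      N₃ , x-near = cauchy x (invℚ C ℚ.* (½ ℚ.* ε)) (*-pos-ℚ (invℚ-pos 0<C) (half-pos 0<ε))
      N₄ , y-near = cauchy y (invℚ B ℚ.* (½ ℚ.* ε)) (*-pos-ℚ (invℚ-pos 0<B) (half-pos 0<ε))
  in (N₁ ℕ.⊔ N₂) ℕ.⊔ (N₃ ℕ.⊔ N₄) , λ m n m≥ n≥ →
    let m≥N₁₂ = ℕ.m⊔n≤o⇒m≤o (N₁ ℕ.⊔ N₂) (N₃ ℕ.⊔ N₄) m≥
        m≥N₃₄ = ℕ.m⊔n≤o⇒n≤o (N₁ ℕ.⊔ N₂) (N₃ ℕ.⊔ N₄) m≥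
        n≥N₁₂ = ℕ.m⊔n≤o⇒m≤o (N₁ ℕ.⊔ N₂) (N₃ ℕ.⊔ N₄) n≥
        n≥N₃₄ = ℕ.m⊔n≤o⇒n≤o (N₁ ℕ.⊔ N₂) (N₃ ℕ.⊔ N₄) n≥
    in *-near (seq x m) (seq y m) (seq x n) (seq y n) B C ε 0<B 0<C
         (x≤B m (ℕ.m⊔n≤o⇒m≤o N₁ N₂ m≥N₁₂)) (y≤C n (ℕ.m⊔n≤o⇒n≤o N₁ N₂ n≥N₁₂))
         (x-near m n (ℕ.m⊔n≤o⇒m≤o N₃ N₄ m≥N₃₄) (ℕ.m⊔n≤o⇒m≤o N₃ N₄ n≥N₃₄))
         (y-near m n (ℕ.m⊔n≤o⇒n≤o N₃ N₄ m≥N₃₄) (ℕ.m⊔n≤o⇒n≤o N₃ N₄ n≥N₃₄))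

*-pos : ∀ x y → 0ℝ < x → 0ℝ < y → 0ℝ < x * y
*-pos x y (δ , 0<δ , M , δ≤x) (ε , 0<ε , N , ε≤y) =
  δ ℚ.* ε , *-pos-ℚ 0<δ 0<ε , M ℕ.⊔ N , λ n M⊔N≤n →
    subst (ℚ._≤ seq x n ℚ.* seq y n) (sym (ℚ.+-identityˡ _))
      (*-mono-ℚ (ℚ.<⇒≤ 0<δ) (0≤y n (ℕ.m⊔n≤o⇒n≤o M N M⊔N≤n))
        (subst (ℚ._≤ seq x n) (ℚ.+-identityˡ δ) (δ≤x n (ℕ.m⊔n≤o⇒m≤o M N M⊔N≤n)))
        (ε≤y′ n (ℕ.m⊔n≤o⇒n≤o M N M⊔N≤n)))
  where
  ε≤y′ : ∀ n → N ℕ.≤ n → ε ℚ.≤ seq y n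
  ε≤y′ n N≤n = subst (ℚ._≤ seq y n) (ℚ.+-identityˡ ε) (ε≤y n N≤n)
  0≤y : ∀ n → N ℕ.≤ n → 0ℚ ℚ.≤ seq y n
  0≤y n N≤n = ℚ.≤-trans (ℚ.<⇒≤ 0<ε) (ε≤y′ n N≤n)

-- The junk value invℚ 0 = 0 occurs for at most finitely many terms, as 0 < x.
recip : (x : ℝ) → 0ℝ < x → ℝ
recip x (δ , 0<δ , M , δ≤x) = mkℝ (λ n → invℚ (seq x n)) prf
  where
  prf : ∀ ε → 0ℚ ℚ.< ε → ∃[ N ] ∀ m n → N ℕ.≤ m → N ℕ.≤ n →
        ∣ invℚ (seq x m) ℚ.- invℚ (seq x n) ∣ ℚ.< ε
  prf ε 0<ε with cauchy x (ε ℚ.* (δ ℚ.* δ)) (*-pos-ℚ 0<ε (*-pos-ℚ 0<δ 0<δ))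
  ... | N , near = M ℕ.⊔ N , λ m n m≥ n≥ →
      go (seq x m) (seq x n)
        (δ≤ m (ℕ.m⊔n≤o⇒m≤o M N m≥)) (δ≤ n (ℕ.m⊔n≤o⇒m≤o M N n≥))
        (near n m (ℕ.m⊔n≤o⇒n≤o M N n≥) (ℕ.m⊔n≤o⇒n≤o M N m≥))
    where
    δ≤ : ∀ n → M ℕ.≤ n → δ ℚ.≤ seq x n
    δ≤ n M≤n = subst (ℚ._≤ seq x n) (ℚ.+-identityˡ δ) (δ≤x n M≤n)
    go : ∀ a b → δ ℚ.≤ a → δ ℚ.≤ b → ∣ b ℚ.- a ∣ ℚ.< ε ℚ.* (δ ℚ.* δ) →
         ∣ invℚ a ℚ.- invℚ b ∣ ℚ.< ε
    go a b δ≤a δ≤b d = ℚ.*-cancelʳ-<-nonNeg (a ℚ.* b) {{ℚ.nonNegative (ℚ.<⇒≤ 0<ab)}}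
      (subst (ℚ._< ε ℚ.* (a ℚ.* b)) eq (ℚ.<-≤-trans d
        (ℚ.*-monoˡ-≤-nonNeg ε {{ℚ.nonNegative (ℚ.<⇒≤ 0<ε)}}
          (*-mono-ℚ (ℚ.<⇒≤ 0<δ) (ℚ.<⇒≤ 0<b) δ≤a δ≤b))))
      where
      0<a = ℚ.<-≤-trans 0<δ δ≤a
      0<b = ℚ.<-≤-trans 0<δ δ≤b
      0<ab = *-pos-ℚ 0<a 0<b
      diff : b ℚ.- a ≡ (invℚ a ℚ.- invℚ b) ℚ.* (a ℚ.* b)
      diff = sym (trans
        (inv-diff a b (invℚ a) (invℚ b))
        (subst₂ (λ u v → u ℚ.* b ℚ.- v ℚ.* a ≡ b ℚ.- a)
          (sym (invℚ-inverse 0<a)) (sym (invℚ-inverse 0<b))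
          (one-diff a b)))
      eq : ∣ b ℚ.- a ∣ ≡ ∣ invℚ a ℚ.- invℚ b ∣ ℚ.* (a ℚ.* b)
      eq = trans (cong ∣_∣ diff) (trans (ℚ.∣p*q∣≡∣p∣*∣q∣ (invℚ a ℚ.- invℚ b) (a ℚ.* b))
        (cong (∣ invℚ a ℚ.- invℚ b ∣ ℚ.*_) (ℚ.0≤p⇒∣p∣≡p (ℚ.<⇒≤ 0<ab))))

infixl 7 _/_[_]

_/_[_] : (x y : ℝ) → 0ℝ < y → ℝ
x / y [ y>0 ] = x * recip y y>0

_⊓_ : ℝ → ℝ → ℝ
x ⊓ y = mkℝ (λ n → seq x n ℚ.⊓ seq y n) prf
  where
  le : ∀ a b c d ε → a ℚ.< c ℚ.+ ε → b ℚ.< d ℚ.+ ε → a ℚ.⊓ b ℚ.< c ℚ.⊓ d ℚ.+ ε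
  le a b c d ε a<c b<d with ℚ.⊓-sel c d
  ... | inj₁ eq = subst (λ u → a ℚ.⊓ b ℚ.< u ℚ.+ ε) (sym eq) (ℚ.≤-<-trans (ℚ.p⊓q≤p a b) a<c)
  ... | inj₂ eq = subst (λ u → a ℚ.⊓ b ℚ.< u ℚ.+ ε) (sym eq) (ℚ.≤-<-trans (ℚ.p⊓q≤q a b) b<d)
  prf : ∀ ε → 0ℚ ℚ.< ε → ∃[ N ] ∀ m n → N ℕ.≤ m → N ℕ.≤ n →
        ∣ seq x m ℚ.⊓ seq y m ℚ.- seq x n ℚ.⊓ seq y n ∣ ℚ.< ε
  prf ε 0<ε with cauchy x ε 0<ε | cauchy y ε 0<ε
  ... | M , x-near | N , y-near = M ℕ.⊔ N , λ m n m≥ n≥ →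
    let dx = x-near m n (ℕ.m⊔n≤o⇒m≤o M N m≥) (ℕ.m⊔n≤o⇒m≤o M N n≥)
        dy = y-near m n (ℕ.m⊔n≤o⇒n≤o M N m≥) (ℕ.m⊔n≤o⇒n≤o M N n≥)
    in ∣∣<-intro (seq x m ℚ.⊓ seq y m) (seq x n ℚ.⊓ seq y n) ε
         (le (seq x m) (seq y m) (seq x n) (seq y n) ε
           (∣∣<-elim (seq x m) (seq x n) dx) (∣∣<-elim (seq y m) (seq y n) dy))
         (le (seq x n) (seq y n) (seq x m) (seq y m) ε
           (∣∣<-elim′ (seq x m) (seq x n) dx) (∣∣<-elim′ (seq y m) (seq y n) dy))

minimum : ∀ {n} .{{_ : NonZero n}} → (Fin n → ℝ) → ℝ
minimum {suc zero}    f = f zero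
minimum {suc (suc n)} f = f zero ⊓ minimum (f ∘ suc)

-- The floor is a relation, since deciding whether a real is an integer is not
-- constructive; at most one k satisfies it, and classically exactly one does.
IsFloor : ℤ → ℝ → Set
IsFloor k x = fromInt k ≤ x × x < fromInt (ℤ.suc k)

distℚ : ℚ → ℚ
distℚ q = (q ℚ.- fromℤ (ℚ.floor q)) ℚ.⊓ (fromℤ (ℤ.suc (ℚ.floor q)) ℚ.- q)

private
  fromℤ-mono : ∀ {i j} → i ℤ.≤ j → fromℤ i ℚ.≤ fromℤ j
  fromℤ-mono i≤j = *≤* (ℤ.*-monoʳ-≤-nonNeg (+ 1) i≤j)

  floor-≤ : ∀ q → fromℤ (ℚ.floor q) ℚ.≤ q
  floor-≤ q@(mkℚ n d _) = *≤* (subst (ℚ.floor q ℤ.* + suc d ℤ.≤_) (sym (ℤ.*-identityʳ n))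
    (ℤ.[n/d]*d≤n n (+ suc d)))

  floor-< : ∀ q → q ℚ.< fromℤ (ℤ.suc (ℚ.floor q))
  floor-< q@(mkℚ n d _) = *<* (subst₂ ℤ._<_ (sym (ℤ.*-identityʳ n))
    (cong (λ k → ℤ.suc k ℤ.* + suc d) (sym (ℤ.div-pos-is-/ℕ n (suc d))))
    (ℤ.n<s[n/ℕd]*d n (suc d)))

distℚ-≤ : ∀ q k → distℚ q ℚ.≤ ∣ q ℚ.- fromℤ k ∣
distℚ-≤ q k with k ℤ.≤? ℚ.floor q
... | yes k≤ = ℚ.≤-trans (ℚ.p⊓q≤p (q ℚ.- fromℤ (ℚ.floor q)) _)
      (ℚ.≤-trans (ℚ.+-monoʳ-≤ q (ℚ.neg-antimono-≤ (fromℤ-mono k≤))) (p≤∣p∣ _))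
... | no k≰ = ℚ.≤-trans (ℚ.p⊓q≤q (q ℚ.- fromℤ (ℚ.floor q)) _)
      (ℚ.≤-trans (ℚ.+-monoˡ-≤ (ℚ.- q) (fromℤ-mono (ℤ.i<j⇒suc[i]≤j (ℤ.≰⇒> k≰))))
        (subst (fromℤ k ℚ.- q ℚ.≤_) (∣∣-sym (fromℤ k) q) (p≤∣p∣ _)))

distℚ-attained : ∀ q → ∃[ k ] distℚ q ≡ ∣ q ℚ.- fromℤ k ∣
distℚ-attained q with ℚ.⊓-sel (q ℚ.- fromℤ (ℚ.floor q)) (fromℤ (ℤ.suc (ℚ.floor q)) ℚ.- q)
... | inj₁ eq = ℚ.floor q , trans eq (sym (ℚ.0≤p⇒∣p∣≡p
      (subst (ℚ._≤ q ℚ.- k) (ℚ.+-inverseʳ k) (ℚ.+-monoˡ-≤ (ℚ.- k) (floor-≤ q)))))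
  where k = fromℤ (ℚ.floor q)
... | inj₂ eq = ℤ.suc (ℚ.floor q) , trans eq (trans (sym (ℚ.0≤p⇒∣p∣≡p
      (subst (ℚ._≤ k ℚ.- q) (ℚ.+-inverseʳ q) (ℚ.+-monoˡ-≤ (ℚ.- q) (ℚ.<⇒≤ (floor-< q))))))
      (∣∣-sym k q))
  where k = fromℤ (ℤ.suc (ℚ.floor q))

private
  distℚ-lipschitz : ∀ p q → distℚ p ℚ.≤ distℚ q ℚ.+ ∣ p ℚ.- q ∣
  distℚ-lipschitz p q with distℚ-attained q
  ... | k , eq = ℚ.≤-trans (distℚ-≤ p k) (subst (λ u → ∣ p ℚ.- fromℤ k ∣ ℚ.≤ u ℚ.+ ∣ p ℚ.- q ∣) (sym eq)
    (subst (λ u → ∣ u ∣ ℚ.≤ ∣ q ℚ.- fromℤ k ∣ ℚ.+ ∣ p ℚ.- q ∣)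
      (tri p q (fromℤ k))
      (ℚ.∣p+q∣≤∣p∣+∣q∣ (q ℚ.- fromℤ k) (p ℚ.- q))))

-- The termwise distance is legitimate because distℚ is 1-Lipschitz.
‖_‖ : ℝ → ℝ
‖ x ‖ = mkℝ (λ n → distℚ (seq x n)) prf
  where
  prf : ∀ ε → 0ℚ ℚ.< ε → ∃[ N ] ∀ m n → N ℕ.≤ m → N ℕ.≤ n →
        ∣ distℚ (seq x m) ℚ.- distℚ (seq x n) ∣ ℚ.< ε
  prf ε 0<ε with cauchy x ε 0<ε
  ... | N , near = N , λ m n m≥ n≥ → ∣∣<-intro (distℚ (seq x m)) (distℚ (seq x n)) ε (le m n m≥ n≥) (le n m n≥ m≥)
    where
    le : ∀ m n → N ℕ.≤ m → N ℕ.≤ n → distℚ (seq x m) ℚ.< distℚ (seq x n) ℚ.+ ε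
    le m n m≥ n≥ = ℚ.≤-<-trans (distℚ-lipschitz (seq x m) (seq x n))
      (ℚ.+-monoʳ-< (distℚ (seq x n)) (near m n m≥ n≥))

recip! : ℕ → ℚ
recip! k = ((+ 1) ℚ./ (k !)) {{k ℕ.!≢0}}

expSum : ℕ → ℚ
expSum zero    = 0ℚ
expSum (suc n) = expSum n ℚ.+ recip! n

private
  recip!-pos : ∀ k → 0ℚ ℚ.< recip! k
  recip!-pos k = ℚ.positive⁻¹ (recip! k) {{ℚ.normalize-pos 1 (k !) {{k ℕ.!≢0}}}}

  toℚᵘ-/ : ∀ d .{{_ : NonZero d}} → ℚ.toℚᵘ ((+ 1) ℚ./ d) ℚᵘ.≃ ((+ 1) ℚᵘ./ d)
  toℚᵘ-/ (suc d) = ℚ.toℚᵘ-fromℚᵘ (ℚᵘ.mkℚᵘ (+ 1) d)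

  ½*/ : ∀ a b .{{_ : NonZero a}} .{{_ : NonZero b}} → 2 ℕ.* a ℕ.≤ b →
        (+ 1) ℚ./ b ℚ.≤ ½ ℚ.* ((+ 1) ℚ./ a)
  ½*/ a@(suc _) b@(suc _) 2a≤b = ℚ.toℚᵘ-cancel-≤
    (ℚᵘ.≤-trans (ℚᵘ.≤-reflexive (toℚᵘ-/ b))
    (ℚᵘ.≤-trans (ℚᵘ.*≤* (subst₂ ℤ._≤_ (sym (ℤ.*-identityˡ _)) (sym (ℤ.*-identityˡ _)) (ℤ.+≤+ 2a≤b)))
    (ℚᵘ.≤-reflexive (ℚᵘ.≃-sym (ℚᵘ.≃-trans (ℚ.toℚᵘ-homo-* ½ ((+ 1) ℚ./ a))
      (ℚᵘ.*-congˡ {ℚ.toℚᵘ ½} (toℚᵘ-/ a)))))))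

  recip!-half : ∀ n → 1 ℕ.≤ n → recip! (suc n) ℚ.≤ ½ ℚ.* recip! n
  recip!-half n 1≤n = ½*/ (n !) (suc n !) {{n ℕ.!≢0}} {{suc n ℕ.!≢0}}
    (ℕ.*-monoˡ-≤ (n !) (ℕ.s≤s 1≤n))

  n≤n! : ∀ n → n ℕ.≤ n !
  n≤n! zero    = ℕ.z≤n
  n≤n! (suc n) = subst (ℕ._≤ suc n !) (ℕ.*-identityʳ (suc n)) (ℕ.*-monoʳ-≤ (suc n) (ℕ.1≤n! n))

  /-small : ∀ ε → 0ℚ ℚ.< ε → ∃[ N ] ∀ d .{{_ : NonZero d}} → N ℕ.≤ d → (+ 1) ℚ./ d ℚ.< ε
  /-small (mkℚ +0 _ _) (*<* (ℤ.+<+ ()))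
  /-small (mkℚ (-[1+ _ ]) _ _) (*<* ())
  /-small ε@(mkℚ +[1+ a ] b _) _ = suc (suc b) , λ where
    d@(suc _) N≤d → ℚ.toℚᵘ-cancel-< (ℚᵘ.≤-<-trans (ℚᵘ.≤-reflexive (toℚᵘ-/ d))
      (ℚᵘ.*<* (subst (ℤ._< + suc a ℤ.* + d) (sym (ℤ.*-identityˡ (+ suc b)))
        (ℤ.+<+ (ℕ.≤-trans N≤d (ℕ.m≤m+n d (a ℕ.* d)))))))

  expSum-mono : ∀ n j → expSum n ℚ.≤ expSum (j ℕ.+ n)
  expSum-mono n zero    = ℚ.≤-refl
  expSum-mono n (suc j) = ℚ.≤-trans (expSum-mono n j)
    (subst (ℚ._≤ expSum (suc j ℕ.+ n)) (ℚ.+-identityʳ _)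
      (ℚ.+-monoʳ-≤ (expSum (j ℕ.+ n)) (ℚ.<⇒≤ (recip!-pos (j ℕ.+ n)))))

  -- expSum n + 2/n! is nonincreasing for n ≥ 1.
  expSum-upper : ∀ n j → 1 ℕ.≤ n → expSum (j ℕ.+ n) ℚ.+ (recip! (j ℕ.+ n) ℚ.+ recip! (j ℕ.+ n))
                 ℚ.≤ expSum n ℚ.+ (recip! n ℚ.+ recip! n)
  expSum-upper n zero    1≤n = ℚ.≤-refl
  expSum-upper n (suc j) 1≤n = ℚ.≤-trans
    (subst (expSum (suc k) ℚ.+ (recip! (suc k) ℚ.+ recip! (suc k)) ℚ.≤_)
      (trans (cong (expSum (suc k) ℚ.+_) (half (recip! k))) (ℚ.+-assoc (expSum k) (recip! k) (recip! k)))
      (ℚ.+-monoʳ-≤ (expSum (suc k)) (ℚ.+-mono-≤ step step)))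
    (expSum-upper n j 1≤n)
    where
    k = j ℕ.+ n
    step = recip!-half k (ℕ.≤-trans 1≤n (ℕ.m≤n+m n j))

e : ℝ
e = mkℝ expSum prf
  where
  prf : ∀ ε → 0ℚ ℚ.< ε → ∃[ N ] ∀ m n → N ℕ.≤ m → N ℕ.≤ n → ∣ expSum m ℚ.- expSum n ∣ ℚ.< ε
  prf ε 0<ε with /-small (½ ℚ.* ε) (half-pos 0<ε)
  ... | M , small = suc M , λ m n m≥ n≥ → ∣∣<-intro (expSum m) (expSum n) ε (le m n m≥ n≥) (le n m n≥ m≥)
    where
    r<½ε : ∀ n → suc M ℕ.≤ n → recip! n ℚ.< ½ ℚ.* ε
    r<½ε n n≥ = small (n !) {{n ℕ.!≢0}} (ℕ.≤-trans (ℕ.n≤1+n M) (ℕ.≤-trans n≥ (n≤n! n)))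
    le : ∀ m n → suc M ℕ.≤ m → suc M ℕ.≤ n → expSum m ℚ.< expSum n ℚ.+ ε
    le m n m≥ n≥ with ℕ.≤-total m n
    ... | inj₁ m≤n = ℚ.≤-<-trans
          (subst (λ k → expSum m ℚ.≤ expSum k) (ℕ.m∸n+n≡m m≤n) (expSum-mono m (n ℕ.∸ m)))
          (subst (ℚ._< expSum n ℚ.+ ε) (ℚ.+-identityʳ _) (ℚ.+-monoʳ-< (expSum n) 0<ε))
    ... | inj₂ n≤m = ℚ.≤-<-trans
          (ℚ.≤-trans
            (subst (ℚ._≤ expSum m ℚ.+ (recip! m ℚ.+ recip! m)) (ℚ.+-identityʳ _)
              (ℚ.+-monoʳ-≤ (expSum m) (ℚ.<⇒≤ (ℚ.+-mono-< (recip!-pos m) (recip!-pos m)))))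
            (subst (λ k → expSum k ℚ.+ (recip! k ℚ.+ recip! k) ℚ.≤ expSum n ℚ.+ (recip! n ℚ.+ recip! n))
              (ℕ.m∸n+n≡m n≤m)
              (expSum-upper n (m ℕ.∸ n) (ℕ.≤-trans (ℕ.s≤s ℕ.z≤n) n≥))))
          (ℚ.+-monoʳ-< (expSum n) (subst (recip! n ℚ.+ recip! n ℚ.<_) (half ε)
            (ℚ.+-mono-< (r<½ε n n≥) (r<½ε n n≥))))

e-pos : 0ℝ < e
e-pos = 1ℚ , ℚ.positive⁻¹ 1ℚ , 1 , λ n 1≤n →
  subst (λ k → 1ℚ ℚ.≤ expSum k) (ℕ.m∸n+n≡m 1≤n) (expSum-mono 1 (n ℕ.∸ 1))

12eα>0 : ∀ α → 0ℝ < α → 0ℝ < fromInt (+ 12) * e * α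
12eα>0 α = *-pos (fromInt (+ 12) * e) α
  (*-pos (fromInt (+ 12)) e (fromInt-pos {+ 12} (ℤ.+<+ (ℕ.s≤s ℕ.z≤n))) e-pos)

-- The supremum of an arbitrary family of reals is formed as a lower Dedekind
-- cut; it need not be given by a convergent sequence with a modulus.  When
-- the family is inhabited and bounded above, this is classically its usual
-- supremum in ℝ, and x <ˡ sup f says that x is strictly below it.
record LowerReal : Set₁ where
  field
    _∋_     : ℚ → Set
    closed  : ∀ {p q} → p ℚ.≤ q → _∋_ q → _∋_ p
    rounded : ∀ {p} → _∋_ p → ∃[ q ] (p ℚ.< q × _∋_ q)

open LowerReal public using (_∋_)

infix 4 _<ˡ_

_<ˡ_ : ℝ → LowerReal → Set
x <ˡ L = ∃[ q ] (x < fromℚ q × L ∋ q)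

sup : {I : Set} → (I → ℝ) → LowerReal
sup f = record { _∋_ = below ; closed = below-closed ; rounded = below-rounded }
  where
  below : ℚ → Set
  below q = ∃[ i ] fromℚ q < f i
  below-closed : ∀ {p q} → p ℚ.≤ q → below q → below p
  below-closed p≤q (i , ε , 0<ε , N , le) = i , ε , 0<ε , N ,
    λ n N≤n → ℚ.≤-trans (ℚ.+-monoˡ-≤ ε p≤q) (le n N≤n)
  below-rounded : ∀ {p} → below p → ∃[ q ] (p ℚ.< q × below q)
  below-rounded {p} (i , ε , 0<ε , N , le) = p ℚ.+ ½ ℚ.* ε ,
    subst (ℚ._< p ℚ.+ ½ ℚ.* ε) (ℚ.+-identityʳ p) (ℚ.+-monoʳ-< p (half-pos 0<ε)) ,
    i , ½ ℚ.* ε , half-pos 0<ε , N , λ n N≤n → subst (ℚ._≤ seq (f i) n)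
      (trans (cong (p ℚ.+_) (sym (half ε))) (sym (ℚ.+-assoc p (½ ℚ.* ε) (½ ℚ.* ε)))) (le n N≤n)

<ˡ-sup⁺ : {I : Set} (f : I → ℝ) (x : ℝ) (i : I) → x < f i → x <ˡ sup f
<ˡ-sup⁺ f x i (ε , 0<ε , M , x+ε≤fi) with cauchy x (½ ℚ.* (½ ℚ.* ε)) (half-pos (half-pos 0<ε))
... | N , near = q , x<q , i , q<fi
  where
  K = M ℕ.⊔ N
  η = ½ ℚ.* (½ ℚ.* ε)
  0<η = half-pos (half-pos 0<ε)
  q = seq x K ℚ.+ ½ ℚ.* ε
  split : ∀ p → p ℚ.+ η ℚ.+ η ≡ p ℚ.+ ½ ℚ.* ε
  split p = trans (ℚ.+-assoc p η η) (cong (p ℚ.+_) (half (½ ℚ.* ε)))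
  x<q : x < fromℚ q
  x<q = η , 0<η , N , λ n N≤n → subst (seq x n ℚ.+ η ℚ.≤_) (split (seq x K))
    (ℚ.<⇒≤ (ℚ.+-monoˡ-< η (∣∣<-elim (seq x n) (seq x K) (near n K N≤n (ℕ.m≤n⊔m M N)))))
  q<fi : fromℚ q < f i
  q<fi = η , 0<η , K , λ n K≤n →
    let n≥M = ℕ.m⊔n≤o⇒m≤o M N K≤n
        n≥N = ℕ.m⊔n≤o⇒n≤o M N K≤n
        near′ = ∣∣<-elim (seq x K) (seq x n) (near K n (ℕ.m≤n⊔m M N) n≥N)
    in ℚ.≤-trans (ℚ.<⇒≤ (ℚ.+-monoˡ-< η (ℚ.+-monoˡ-< (½ ℚ.* ε) near′)))
         (subst (ℚ._≤ seq (f i) n) (sym (regroup (seq x n) ε)) (x+ε≤fi n n≥M))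

<ˡ-sup⁻ : {I : Set} (f : I → ℝ) (x : ℝ) → x <ˡ sup f → ∃[ i ] x < f i
<ˡ-sup⁻ f x (q , (ε , 0<ε , M , x+ε≤q) , i , (δ , 0<δ , N , q+δ≤fi)) =
  i , ε , 0<ε , M ℕ.⊔ N , λ n n≥ →
    ℚ.≤-trans (x+ε≤q n (ℕ.m⊔n≤o⇒m≤o M N n≥))
      (ℚ.≤-trans (subst (ℚ._≤ q ℚ.+ δ) (ℚ.+-identityʳ q) (ℚ.+-monoʳ-≤ q (ℚ.<⇒≤ 0<δ)))
        (q+δ≤fi n (ℕ.m⊔n≤o⇒n≤o M N n≥)))

ML : ∀ {n} .{{_ : NonZero n}} → (Fin n → ℝ) → LowerReal
ML v = sup λ (t : ℝ) → minimum λ i → ‖ t * v i ‖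

{-# OPTIONS --safe #-}
module Submission where

-- Peres–Schlag sieve.  With δ = α/(n+c), the times at which runner i is within
-- δ of the origin are covered by dyadic cells of length about δ/vᵢ.  Since
-- vᵢ ≥ vⱼ/δ whenever j ≤ i − h, the cells of such j are so long that the i-th
-- bad set has density at most 10δ in each of them.  Hence, if Sᵢ is the measure of the
-- times good for the first i runners, Sᵢ − Sᵢ₊₁ ≤ 10δ Sᵢ₋ₕ.  Inductively
-- Sᵢ₊₁ ≥ (1 − 1/H) Sᵢ, where H is the least multiple of 4 above h: by
-- Bernoulli's inequality over four quarters of H steps, Sᵢ ≥ (3/4)⁴ Sᵢ₋ₕ, and
-- 10δ (4/3)⁴ H ≤ 1 because h ≤ 1/(12eδ), 12e > 32 and δ is small.
--
-- For integer speeds all of this is a count of dyadic cells.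
-- Real speeds are replaced by one term of their Cauchy sequences; the time found
-- is at most 1/v₁, a bound which does not depend on the term chosen, so the
-- approximation error at that time can be made small in advance.

module IntegerSpeeds where

  open import Data.Nat.Base
  open import Data.Nat.Properties
  open import Data.Nat.DivMod
  open import Data.Nat.Divisibility using (divides)
  open import Data.Nat.Solver using (module +-*-Solver)
  open import Data.Product.Base using (∃-syntax; _×_; _,_; proj₁; proj₂)
  open import Data.Sum.Base using (_⊎_; inj₁; inj₂; [_,_]′)
  open import Function.Base using (_∘_; it)
  open import Relation.Binary.PropositionalEquality
  open import Relation.Nullary
  open import Relation.Nullary.Decidable using (_×-dec_)
  open +-*-Solver using (solve; _:=_; _:+_; _:*_; con)

  -- Finite sums and indicators

  Σ< : ℕ → (ℕ → ℕ) → ℕ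
  Σ< zero    f = 0
  Σ< (suc n) f = f 0 + Σ< n (f ∘ suc)

  Σ<-mono : ∀ n {f g} → (∀ i → i < n → f i ≤ g i) → Σ< n f ≤ Σ< n g
  Σ<-mono zero    f≤g = z≤n
  Σ<-mono (suc n) f≤g = +-mono-≤ (f≤g 0 z<s) (Σ<-mono n λ i i<n → f≤g (suc i) (s<s i<n))

  Σ<-cong : ∀ n {f g} → (∀ i → i < n → f i ≡ g i) → Σ< n f ≡ Σ< n g
  Σ<-cong n f≡g = ≤-antisym (Σ<-mono n λ i i<n → ≤-reflexive (f≡g i i<n))
                            (Σ<-mono n λ i i<n → ≤-reflexive (sym (f≡g i i<n)))

  Σ<-+ : ∀ n f g → Σ< n (λ i → f i + g i) ≡ Σ< n f + Σ< n g
  Σ<-+ zero    f g = refl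
  Σ<-+ (suc n) f g rewrite Σ<-+ n (f ∘ suc) (g ∘ suc) =
    solve 4 (λ a b c d → (a :+ b) :+ (c :+ d) := (a :+ c) :+ (b :+ d)) refl
      (f 0) (g 0) (Σ< n (f ∘ suc)) (Σ< n (g ∘ suc))

  Σ<-* : ∀ n a f → Σ< n (λ i → a * f i) ≡ a * Σ< n f
  Σ<-* zero    a f = sym (*-zeroʳ a)
  Σ<-* (suc n) a f rewrite Σ<-* n a (f ∘ suc) = sym (*-distribˡ-+ a (f 0) _)

  Σ<-const : ∀ n a → Σ< n (λ _ → a) ≡ n * a
  Σ<-const zero    a = refl
  Σ<-const (suc n) a = cong (a +_) (Σ<-const n a)

  Σ<-split : ∀ m n f → Σ< (m + n) f ≡ Σ< m f + Σ< n (λ i → f (m + i))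
  Σ<-split zero    n f = refl
  Σ<-split (suc m) n f = trans (cong (f 0 +_) (Σ<-split m n (f ∘ suc))) (sym (+-assoc (f 0) _ _))

  Σ<-blocks : ∀ a b f → Σ< (a * b) f ≡ Σ< a (λ q → Σ< b (λ r → f (q * b + r)))
  Σ<-blocks zero    b f = refl
  Σ<-blocks (suc a) b f = trans (Σ<-split b (a * b) f) (cong (Σ< b f +_)
    (trans (Σ<-blocks a b (λ i → f (b + i)))
      (Σ<-cong a λ q _ → Σ<-cong b λ r _ → cong f (sym (+-assoc b (q * b) r)))))

  Σ<-pos : ∀ n f → 0 < Σ< n f → ∃[ k ] (k < n × 0 < f k)
  Σ<-pos (suc n) f 0<Σ with f 0 in eq
  ... | suc x = 0 , z<s , subst (0 <_) (sym eq) z<s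
  ... | zero with Σ<-pos n (f ∘ suc) 0<Σ
  ...   | k , k<n , 0<fk = suc k , s<s k<n , 0<fk

  𝟙 : {A : Set} → Dec A → ℕ
  𝟙 (yes _) = 1
  𝟙 (no _)  = 0

  𝟙-≤ : {A : Set} (d : Dec A) {x : ℕ} → (A → 1 ≤ x) → 𝟙 d ≤ x
  𝟙-≤ (yes a) f = f a
  𝟙-≤ (no _)  f = z≤n

  𝟙-yes : {A : Set} (d : Dec A) → A → 1 ≤ 𝟙 d
  𝟙-yes (yes _) _ = ≤-refl
  𝟙-yes (no ¬a) a = contradiction a ¬a

  𝟙≡0 : {A : Set} (d : Dec A) → 𝟙 d ≡ 0 → ¬ A
  𝟙≡0 (no ¬a) _ = ¬a

  -- Terms of an arithmetic progression in a window or an arc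

  between? : ∀ lo hi y → Dec (lo ≤ y × y ≤ hi)
  between? lo hi y = lo ≤? y ×-dec y ≤? hi

  -- Hits are `v` apart, so each one uses up `v` of the window. Starting the window at `lo ⊔ β`
  -- makes the induction work: passing from `β` to `β + v` after a hit shortens the bound by exactly
  -- `v`.
  progression-count : ∀ N v β lo hi →
    v * Σ< N (λ r → 𝟙 (between? lo hi (β + r * v))) ≤ (hi + v) ∸ (lo ⊔ β)
  progression-count zero    v β lo hi rewrite *-zeroʳ v = z≤n
  progression-count (suc N) v β lo hi = step (between? lo hi (β + 0))
    where
    rest : ℕ
    rest = Σ< N (λ r → 𝟙 (between? lo hi (β + suc r * v)))
    rest-eq : Σ< N (λ r → 𝟙 (between? lo hi (β + v + r * v))) ≡ rest
    rest-eq = Σ<-cong N λ r _ → cong (𝟙 ∘ between? lo hi) (+-assoc β v (r * v))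
    ih : v * rest ≤ (hi + v) ∸ (lo ⊔ (β + v))
    ih = subst (λ x → v * x ≤ (hi + v) ∸ (lo ⊔ (β + v))) rest-eq (progression-count N v (β + v) lo hi)
    step : (d : Dec (lo ≤ β + 0 × β + 0 ≤ hi)) → v * (𝟙 d + rest) ≤ (hi + v) ∸ (lo ⊔ β)
    step (no _) = ≤-trans ih (∸-monoʳ-≤ (hi + v) (⊔-monoʳ-≤ lo (m≤m+n β v)))
    step (yes (lo≤β+0 , β+0≤hi)) = begin
      v * suc rest            ≡⟨ *-suc v rest ⟩
      v + v * rest            ≤⟨ +-monoʳ-≤ v ih ⟩
      v + ((hi + v) ∸ (lo ⊔ (β + v))) ≤⟨ +-monoʳ-≤ v (∸-monoʳ-≤ (hi + v) (m≤n⊔m lo (β + v))) ⟩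
      v + ((hi + v) ∸ (β + v)) ≡⟨ cong (v +_) ([m+n]∸[o+n] hi v β) ⟩
      v + (hi ∸ β)            ≡⟨ sym (+-∸-assoc v β≤hi) ⟩
      (v + hi) ∸ β            ≡⟨ cong (_∸ β) (+-comm v hi) ⟩
      (hi + v) ∸ β            ≡⟨ cong (hi + v ∸_) (sym (m≤n⇒m⊔n≡n lo≤β)) ⟩
      (hi + v) ∸ (lo ⊔ β)     ∎
      where
      open ≤-Reasoning
      lo≤β = subst (lo ≤_) (+-identityʳ β) lo≤β+0
      β≤hi = subst (_≤ hi) (+-identityʳ β) β+0≤hi
      [m+n]∸[o+n] : ∀ m n o → (m + n) ∸ (o + n) ≡ m ∸ o
      [m+n]∸[o+n] m n o = trans (cong₂ _∸_ (+-comm m n) (+-comm o n)) ([m+n]∸[m+o]≡n∸o n m o)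

  private
    -- A stretch of length M meets the arc [0, A] mod M in at most two pieces of total length A.
    arc-count-reduced : ∀ N v β M A .{{_ : NonZero M}} .{{_ : NonZero v}} → β < M → N * v ≤ M →
      v * Σ< N (λ r → 𝟙 ((β + r * v) % M ≤? A)) ≤ A + 2 * v
    arc-count-reduced N v β M A β<M Nv≤M = begin
      v * Σ< N (λ r → 𝟙 ((β + r * v) % M ≤? A)) ≤⟨ *-monoʳ-≤ v (Σ<-mono N split) ⟩
      v * Σ< N (λ r → first r + second r) ≡⟨ cong (v *_) (Σ<-+ N first second) ⟩
      v * (Σ< N first + Σ< N second) ≡⟨ *-distribˡ-+ v (Σ< N first) (Σ< N second) ⟩
      v * Σ< N first + v * Σ< N second
        ≤⟨ +-mono-≤ (progression-count N v β 0 A) (progression-count N v β M (M + (A ⊓ β))) ⟩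
      (A + v ∸ β) + (M + (A ⊓ β) + v ∸ (M ⊔ β)) ≡⟨ cong ((A + v ∸ β) +_) simp ⟩
      (A + v ∸ β) + ((A ⊓ β) + v) ≤⟨ fin ⟩
      A + 2 * v ∎
      where
      open ≤-Reasoning
      first second : ℕ → ℕ
      first r = 𝟙 (between? 0 A (β + r * v))
      -- The progression ends before `β + M`, so residues in the second turn are below `β`. The cap
      -- `A ⊓ β` prevents any part of the arc from being paid for twice.
      second r = 𝟙 (between? M (M + (A ⊓ β)) (β + r * v))
      simp : M + (A ⊓ β) + v ∸ (M ⊔ β) ≡ (A ⊓ β) + v
      simp = trans (cong₂ _∸_ (+-assoc M (A ⊓ β) v) (m≥n⇒m⊔n≡m (<⇒≤ β<M))) (m+n∸m≡n M _)
      split : ∀ r → r < N → 𝟙 ((β + r * v) % M ≤? A) ≤ first r + second r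
      split r r<N = 𝟙-≤ ((β + r * v) % M ≤? A) λ y%M≤A → case y%M≤A
        where
        y = β + r * v
        y<β+M : y < β + M
        y<β+M = +-monoʳ-< β (<-≤-trans (*-monoˡ-< v r<N) Nv≤M)
        case : y % M ≤ A → 1 ≤ first r + second r
        case y%M≤A with y <? M
        ... | yes y<M = ≤-trans (𝟙-yes (between? 0 A y) (z≤n , subst (_≤ A) (m<n⇒m%n≡m y<M) y%M≤A)) (m≤m+n _ _)
        ... | no y≮M = ≤-trans (𝟙-yes (between? M (M + (A ⊓ β)) y) (M≤y , y≤)) (m≤n+m _ (first r))
          where
          M≤y = ≮⇒≥ y≮M
          z = y ∸ M
          M+z : M + z ≡ y
          M+z = m+[n∸m]≡n M≤y
          z<β : z < β
          z<β = +-cancelˡ-< M z β (subst₂ _<_ (sym M+z) (+-comm β M) y<β+M)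
          y%M : y % M ≡ z
          y%M = trans (cong (_% M) (trans (sym M+z) (+-comm M z)))
                  (trans ([m+n]%n≡m%n z M) (m<n⇒m%n≡m (<-trans z<β β<M)))
          y≤ : y ≤ M + (A ⊓ β)
          y≤ = subst (_≤ M + (A ⊓ β)) M+z (+-monoʳ-≤ M (⊓-glb (subst (_≤ A) y%M y%M≤A) (<⇒≤ z<β)))
      rearr : A + v + v ≡ A + 2 * v
      rearr = solve 2 (λ a v → a :+ v :+ v := a :+ con 2 :* v) refl A v
      fin : (A + v ∸ β) + ((A ⊓ β) + v) ≤ A + 2 * v
      fin with β ≤? A
      ... | yes β≤A = begin
        (A + v ∸ β) + ((A ⊓ β) + v) ≡⟨ cong (λ x → (A + v ∸ β) + (x + v)) (m≥n⇒m⊓n≡n β≤A) ⟩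
        (A + v ∸ β) + (β + v) ≡⟨ sym (+-assoc (A + v ∸ β) β v) ⟩
        (A + v ∸ β) + β + v ≡⟨ cong (_+ v) (m∸n+n≡m (≤-trans β≤A (m≤m+n A v))) ⟩
        A + v + v ≡⟨ rearr ⟩
        A + 2 * v ∎
      ... | no β≰A = begin
        (A + v ∸ β) + ((A ⊓ β) + v) ≤⟨ +-mono-≤ (∸-monoʳ-≤ (A + v) (<⇒≤ (≰⇒> β≰A))) (+-monoˡ-≤ v (m⊓n≤m A β)) ⟩
        (A + v ∸ A) + (A + v) ≡⟨ cong (_+ (A + v)) (m+n∸m≡n A v) ⟩
        v + (A + v) ≡⟨ +-comm v (A + v) ⟩
        A + v + v ≡⟨ rearr ⟩
        A + 2 * v ∎

  -- By `N * v ≤ M` the progression makes at most one turn, so it meets the arc in at most two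
  -- windows; each contributes one extra `v`.
  arc-count : ∀ N v β M A .{{_ : NonZero M}} .{{_ : NonZero v}} → N * v ≤ M →
    v * Σ< N (λ r → 𝟙 ((β + r * v) % M ≤? A)) ≤ A + 2 * v
  arc-count N v β M A Nv≤M = subst (λ x → v * x ≤ A + 2 * v)
    (Σ<-cong N λ r _ → cong (λ y → 𝟙 (y ≤? A)) (reduce (r * v)))
    (arc-count-reduced N v (β % M) M A (m%n<n β M) Nv≤M)
    where
    reduce : ∀ x → (β % M + x) % M ≡ (β + x) % M
    reduce x = sym (trans (cong (λ b → (b + x) % M) (m≡m%n+[m/n]*n β M))
      (trans (cong (_% M) (solve 3 (λ a b c → a :+ b :+ c := a :+ c :+ b) refl (β % M) (β / M * M) x))
        ([m+kn]%n≡m%n (β % M + x) (β / M) M)))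

  -- Dyadic scales and blocks

  n<2^n : ∀ n → n < 2 ^ n
  n<2^n zero    = z<s
  n<2^n (suc n) = begin-strict
    suc n           <⟨ s<s (n<2^n n) ⟩
    suc (2 ^ n)     ≤⟨ +-monoˡ-≤ (2 ^ n) (m^n>0 2 n) ⟩
    2 ^ n + 2 ^ n   ≡⟨ cong (2 ^ n +_) (sym (+-identityʳ (2 ^ n))) ⟩
    2 ^ suc n       ∎
    where open ≤-Reasoning

  -- At the first `l` with `x ≤ p * 2 ^ l` the previous value was still below `x`, and doubling it
  -- stays below `2 * x`. The search can stop at exponent `x` because `x < 2 ^ x`.
  dyadic-scale : ∀ p x → 1 ≤ p → p ≤ x → ∃[ l ] (x ≤ p * 2 ^ l × p * 2 ^ l < 2 * x)
  dyadic-scale p x 1≤p p≤x with search x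
    where
    2*-eq : ∀ n → p * 2 ^ suc n ≡ 2 * (p * 2 ^ n)
    2*-eq n = solve 2 (λ p q → p :* (con 2 :* q) := con 2 :* (p :* q)) refl p (2 ^ n)
    test : ∀ n → p * 2 ^ n < 2 * x → (∃[ l ] (x ≤ p * 2 ^ l × p * 2 ^ l < 2 * x)) ⊎ p * 2 ^ n < x
    test n small with x ≤? p * 2 ^ n
    ... | yes x≤ = inj₁ (n , x≤ , small)
    ... | no x≰  = inj₂ (≰⇒> x≰)
    search : ∀ n → (∃[ l ] (x ≤ p * 2 ^ l × p * 2 ^ l < 2 * x)) ⊎ p * 2 ^ n < x
    search zero = test 0 (begin-strict
      p * 1     ≡⟨ *-identityʳ p ⟩
      p         ≤⟨ p≤x ⟩
      x         <⟨ m<m+n x (≤-trans 1≤p p≤x) ⟩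
      x + x     ≡⟨ cong (x +_) (sym (+-identityʳ x)) ⟩
      2 * x     ∎)
      where open ≤-Reasoning
    search (suc n) with search n
    ... | inj₁ found = inj₁ found
    ... | inj₂ small = test (suc n) (subst (_< 2 * x) (sym (2*-eq n)) (*-monoʳ-< 2 small))
  ... | inj₁ found = found
  ... | inj₂ p2^x<x = contradiction
    (<-≤-trans (n<2^n x) (subst (_≤ p * 2 ^ x) (*-identityˡ (2 ^ x)) (*-monoˡ-≤ (2 ^ x) 1≤p)))
    (<-asym p2^x<x)

  infixl 7 _≫_

  _≫_ : ℕ → ℕ → ℕ
  k ≫ a = _/_ k (2 ^ a) {{m^n≢0 2 a}}

  ≫-≫ : ∀ k a b → (k ≫ a) ≫ b ≡ k ≫ (a + b)
  ≫-≫ k a b = trans (m/n/o≡m/[n*o] k (2 ^ a) (2 ^ b) {{m^n≢0 2 a}} {{m^n≢0 2 b}} {{nz}})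
    (/-congʳ {{nz}} {{m^n≢0 2 (a + b)}} (sym (^-distribˡ-+-* 2 a b)))
    where nz = m*n≢0 (2 ^ a) (2 ^ b) {{m^n≢0 2 a}} {{m^n≢0 2 b}}

  -- Discrete measurability with respect to the partition into dyadic blocks of length `2 ^ a`.
  DependsOnBlock : ℕ → (ℕ → ℕ) → Set
  DependsOnBlock a f = ∀ k k′ → k ≫ a ≡ k′ ≫ a → f k ≡ f k′

  refine-block : ∀ {a b f} → a ≤ b → DependsOnBlock b f → DependsOnBlock a f
  refine-block {a} {b} a≤b dep k k′ eq = dep k k′
    (trans (sym (coarser k)) (trans (cong (_≫ (b ∸ a)) eq) (coarser k′)))
    where
    coarser : ∀ k → (k ≫ a) ≫ (b ∸ a) ≡ k ≫ b
    coarser k = trans (≫-≫ k a (b ∸ a)) (cong (k ≫_) (m+[n∸m]≡n a≤b))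

  [q*2^a+r]≫a : ∀ q a r → r < 2 ^ a → (q * 2 ^ a + r) ≫ a ≡ q
  [q*2^a+r]≫a q a r r<d = trans (+-distrib-/-∣ˡ r {{nz}} (divides q refl))
    (trans (cong₂ _+_ (m*n/n≡m q (2 ^ a) {{nz}}) (m<n⇒m/n≡0 {{nz}} r<d)) (+-identityʳ q))
    where nz = m^n≢0 2 a

  -- A substitute for independence: `f` is constant on each block of length `2 ^ a`, so it factors
  -- out of the block sum and the density bound `C / Q` for `b` applies block by block.
  weighted-density : ∀ T a (f b : ℕ → ℕ) (C Q : ℕ) → a ≤ T → DependsOnBlock a f →
    (∀ q → Q * Σ< (2 ^ a) (λ r → b (q * 2 ^ a + r)) ≤ C * 2 ^ a) →
    Q * Σ< (2 ^ T) (λ k → f k * b k) ≤ C * Σ< (2 ^ T) f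
  weighted-density T a f b C Q a≤T dep dense = subst (λ N → Q * Σ< N (λ k → f k * b k) ≤ C * Σ< N f) U*R (begin
    Q * Σ< (U * R) (λ k → f k * b k)
      ≡⟨ cong (Q *_) (Σ<-blocks U R _) ⟩
    Q * Σ< U (λ q → Σ< R (λ r → f (q * R + r) * b (q * R + r)))
      ≡⟨ cong (Q *_) (Σ<-cong U λ q _ → trans (Σ<-cong R λ r r<R → cong (_* b (q * R + r)) (const q r r<R)) (Σ<-* R (f (q * R)) _)) ⟩
    Q * Σ< U (λ q → f (q * R) * Σ< R (λ r → b (q * R + r)))
      ≡⟨ sym (Σ<-* U Q _) ⟩
    Σ< U (λ q → Q * (f (q * R) * Σ< R (λ r → b (q * R + r))))
      ≤⟨ Σ<-mono U (λ q _ → block q) ⟩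
    Σ< U (λ q → C * (R * f (q * R)))
      ≡⟨ Σ<-* U C _ ⟩
    C * Σ< U (λ q → R * f (q * R))
      ≡⟨ cong (C *_) (Σ<-cong U λ q _ → trans (sym (Σ<-const R (f (q * R)))) (Σ<-cong R λ r r<R → sym (const q r r<R))) ⟩
    C * Σ< U (λ q → Σ< R (λ r → f (q * R + r)))
      ≡⟨ cong (C *_) (sym (Σ<-blocks U R f)) ⟩
    C * Σ< (U * R) f ∎)
    where
    open ≤-Reasoning
    U = 2 ^ (T ∸ a)
    R = 2 ^ a
    U*R : U * R ≡ 2 ^ T
    U*R = trans (sym (^-distribˡ-+-* 2 (T ∸ a) a)) (cong (2 ^_) (m∸n+n≡m a≤T))
    const : ∀ q r → r < R → f (q * R + r) ≡ f (q * R)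
    const q r r<R = dep _ _ (trans ([q*2^a+r]≫a q a r r<R) (sym (m*n/n≡m q R {{m^n≢0 2 a}})))
    block : ∀ q → Q * (f (q * R) * Σ< R (λ r → b (q * R + r))) ≤ C * (R * f (q * R))
    block q = begin
      Q * (f (q * R) * Σ< R (λ r → b (q * R + r)))
        ≡⟨ solve 3 (λ Q F S → Q :* (F :* S) := F :* (Q :* S)) refl Q (f (q * R)) _ ⟩
      f (q * R) * (Q * Σ< R (λ r → b (q * R + r)))
        ≤⟨ *-monoʳ-≤ (f (q * R)) (dense q) ⟩
      f (q * R) * (C * R)
        ≡⟨ solve 3 (λ F C R → F :* (C :* R) := C :* (R :* F)) refl (f (q * R)) C R ⟩
      C * (R * f (q * R)) ∎

  -- Slowly decreasing sequences and Bernoulli's inequality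

  module Decay (S : ℕ → ℕ) (S-anti : ∀ i → S (suc i) ≤ S i) (k : ℕ) where

    H : ℕ
    H = k * 4

    -- The inequality `S (suc j) ≥ (1 - 1/H) S j`, cleared of denominators and of subtraction.
    Step : ℕ → Set
    Step j = H * S j ≤ H * S (suc j) + S j

    S-anti-+ : ∀ j r → S (j + r) ≤ S j
    S-anti-+ j zero    = ≤-reflexive (cong S (+-identityʳ j))
    S-anti-+ j (suc r) = ≤-trans (subst (λ x → S x ≤ S (j + r)) (sym (+-suc j r)) (S-anti (j + r))) (S-anti-+ j r)

    -- Each of the `r` steps loses at most a fraction `1/H` of the current value, which by
    -- monotonicity is at most `S j / H`.
    bernoulli : ∀ j r → (∀ i → i < j + r → Step i) → H * S j ≤ H * S (j + r) + r * S j
    bernoulli j zero steps = ≤-reflexive (trans (cong (λ x → H * S x) (sym (+-identityʳ j))) (sym (+-identityʳ _)))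
    bernoulli j (suc r) steps = begin
      H * S j ≤⟨ bernoulli j r (λ i i< → steps i (subst (i <_) (sym (+-suc j r)) (m≤n⇒m≤1+n i<))) ⟩
      H * S (j + r) + r * S j ≤⟨ +-monoˡ-≤ (r * S j) (steps (j + r) (subst (j + r <_) (sym (+-suc j r)) ≤-refl)) ⟩
      H * S (suc (j + r)) + S (j + r) + r * S j ≤⟨ +-monoˡ-≤ (r * S j) (+-monoʳ-≤ (H * S (suc (j + r))) (S-anti-+ j r)) ⟩
      H * S (suc (j + r)) + S j + r * S j ≡⟨ +-assoc (H * S (suc (j + r))) (S j) (r * S j) ⟩
      H * S (suc (j + r)) + suc r * S j ≡⟨ cong (λ x → H * S x + suc r * S j) (sym (+-suc j r)) ⟩
      H * S (j + suc r) + suc r * S j ∎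
      where open ≤-Reasoning

    quarter : .{{_ : NonZero k}} → ∀ j r → r ≤ k → (∀ i → i < j + r → Step i) → 3 * S j ≤ 4 * S (j + r)
    quarter j r r≤k steps = *-cancelˡ-≤ k (+-cancelʳ-≤ (k * S j) _ _ (begin
      k * (3 * S j) + k * S j ≡⟨ solve 2 (λ k s → k :* (con 3 :* s) :+ k :* s := k :* con 4 :* s) refl k (S j) ⟩
      H * S j ≤⟨ bernoulli j r steps ⟩
      H * S (j + r) + r * S j ≤⟨ +-monoʳ-≤ (H * S (j + r)) (*-monoˡ-≤ (S j) r≤k) ⟩
      H * S (j + r) + k * S j ≡⟨ cong (_+ k * S j) (solve 2 (λ k s → k :* con 4 :* s := k :* (con 4 :* s)) refl k (S (j + r))) ⟩
      k * (4 * S (j + r)) + k * S j ∎))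
      where open ≤-Reasoning

    quarters : .{{_ : NonZero k}} → ∀ a j d → d ≤ a * k → (∀ i → i < j + d → Step i) → 3 ^ a * S j ≤ 4 ^ a * S (j + d)
    quarters zero j zero z≤n steps = ≤-reflexive (cong (λ x → S x + 0) (sym (+-identityʳ j)))
    quarters (suc a) j d d≤ steps = begin
      3 ^ suc a * S j ≡⟨ solve 2 (λ x s → con 3 :* x :* s := x :* (con 3 :* s)) refl (3 ^ a) (S j) ⟩
      3 ^ a * (3 * S j) ≤⟨ *-monoʳ-≤ (3 ^ a) (quarter j r (m⊓n≤n d k) (λ i i< → steps i (<-≤-trans i< (+-monoʳ-≤ j (m⊓n≤m d k))))) ⟩
      3 ^ a * (4 * S (j + r)) ≡⟨ solve 2 (λ x s → x :* (con 4 :* s) := con 4 :* (x :* s)) refl (3 ^ a) (S (j + r)) ⟩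
      4 * (3 ^ a * S (j + r)) ≤⟨ *-monoʳ-≤ 4 (quarters a (j + r) (d ∸ k) d∸k≤ (λ i i< → steps i (subst (i <_) j+r+ i<))) ⟩
      4 * (4 ^ a * S (j + r + (d ∸ k))) ≡⟨ cong (λ x → 4 * (4 ^ a * S x)) j+r+ ⟩
      4 * (4 ^ a * S (j + d)) ≡⟨ sym (*-assoc 4 (4 ^ a) (S (j + d))) ⟩
      4 ^ suc a * S (j + d) ∎
      where
      open ≤-Reasoning
      r = d ⊓ k
      d∸k≤ : d ∸ k ≤ a * k
      d∸k≤ = subst (d ∸ k ≤_) (m+n∸m≡n k (a * k)) (∸-monoˡ-≤ k d≤)
      j+r+ : j + r + (d ∸ k) ≡ j + d
      j+r+ = trans (+-assoc j r (d ∸ k)) (cong (j +_) (trans (cong (_+ (d ∸ k)) (⊓-comm d k)) (m⊓n+n∸m≡n k d)))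

    -- Bernoulli over `H` steps at once would only give the trivial bound 0. Four windows of at most
    -- `k = H/4` steps each keep three quarters, and `(3/4)^4 = 81/256`.
    decay : .{{_ : NonZero k}} → ∀ {j i} d → j + d ≡ i → d ≤ H → (∀ l → l < i → Step l) → 81 * S j ≤ 256 * S i
    decay {j} d refl d≤H steps = quarters 4 j d (subst (d ≤_) (*-comm k 4) d≤H) steps

  -- The sieve

  j<i∸h⇒j+h<i : ∀ j i h → j < i ∸ h → j + h < i
  j<i∸h⇒j+h<i j i h j< = subst (j + h <_) (m∸n+n≡m (<⇒≤ h<i)) (+-monoˡ-< h j<)
    where
    h<i : h < i
    h<i = m∸n≢0⇒n<m λ eq → contradiction (subst (j <_) eq j<) λ ()

  m*n>0⇒m>0 : ∀ m n → 0 < m * n → 0 < m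
  m*n>0⇒m>0 (suc m) n _ = z<s

  -- `coarse` and `fine` are exponents of block lengths. By `nested`, conditions at least `h`
  -- indices before `i` are constant on the blocks in which the density of `b i` is controlled, so
  -- `b i` behaves as if independent of them.
  module Sieve
    (n h T C Q k : ℕ) .{{_ : NonZero k}} .{{_ : NonZero Q}}
    (b : ℕ → ℕ → ℕ) (coarse fine : ℕ → ℕ)
    (h≤k*4 : h ≤ k * 4)
    (small : C * (k * 4) * 256 ≤ Q * 81)
    (coarse≤T : ∀ i → i < n → coarse i ≤ T)
    (nested : ∀ i j → i < n → j + h ≤ i → coarse i ≤ fine j)
    (block : ∀ i → i < n → DependsOnBlock (fine i) (b i))
    (dense : ∀ i → i < n → ∀ q → Q * Σ< (2 ^ coarse i) (λ r → b i (q * 2 ^ coarse i + r)) ≤ C * 2 ^ coarse i)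
    where

    good : ℕ → ℕ → ℕ
    good zero    x = 1
    good (suc i) x = good i x * (1 ∸ b i x)

    S : ℕ → ℕ
    S i = Σ< (2 ^ T) (good i)

    good-anti : ∀ i x → good (suc i) x ≤ good i x
    good-anti i x = subst (good (suc i) x ≤_) (*-identityʳ _) (*-monoʳ-≤ (good i x) (m∸n≤m 1 (b i x)))

    good-anti-+ : ∀ i r x → good (i + r) x ≤ good i x
    good-anti-+ i zero    x = ≤-reflexive (cong (λ y → good y x) (+-identityʳ i))
    good-anti-+ i (suc r) x = ≤-trans (subst (λ y → good y x ≤ good (i + r) x) (sym (+-suc i r)) (good-anti (i + r) x)) (good-anti-+ i r x)

    good-block : ∀ a i → i ≤ n → (∀ j → j < i → a ≤ fine j) → DependsOnBlock a (good i)
    good-block a zero    i≤n a≤ x y eq = refl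
    good-block a (suc i) i<n a≤ x y eq = cong₂ (λ g c → g * (1 ∸ c))
      (good-block a i (<⇒≤ i<n) (λ j j<i → a≤ j (m≤n⇒m≤1+n j<i)) x y eq)
      (refine-block {a} {fine i} (a≤ i ≤-refl) (block i i<n) x y eq)

    good-nonzero : ∀ i x → 0 < good i x → ∀ j → j < i → b j x ≡ 0
    good-nonzero (suc i) x 0<g j j<1+i = [ good-nonzero i x (m*n>0⇒m>0 _ _ 0<g) j , (λ { refl → b≡0 }) ]′
      (m≤n⇒m<n∨m≡n (s≤s⁻¹ j<1+i))
      where
      b≡0 : b i x ≡ 0
      b≡0 = n<1⇒n≡0 (m∸n≢0⇒n<m λ eq → <-irrefl (sym (trans (cong (good i x *_) eq) (*-zeroʳ (good i x)))) 0<g)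

    open Decay S (λ i → Σ<-mono (2 ^ T) λ x _ → good-anti i x) k

    loss : ℕ → ℕ
    loss i = Σ< (2 ^ T) (λ x → good i x * b i x)

    S≤S+loss : ∀ i → S i ≤ S (suc i) + loss i
    S≤S+loss i = subst (S i ≤_) (Σ<-+ (2 ^ T) (good (suc i)) (λ x → good i x * b i x))
      (Σ<-mono (2 ^ T) λ x _ → subst₂ _≤_ (*-identityʳ (good i x)) (*-distribˡ-+ (good i x) (1 ∸ b i x) (b i x))
        (*-monoʳ-≤ (good i x) (≤-trans (m≤n+m∸n 1 (b i x)) (≤-reflexive (+-comm (b i x) _)))))

    -- Only the h most recent conditions can be correlated with the i-th one; dropping them costs a bounded factor.
    step : ∀ i → i < n → (∀ j → j < i → Step j) → Step i
    step i i<n steps = begin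
      H * S i                       ≤⟨ *-monoʳ-≤ H (S≤S+loss i) ⟩
      H * (S (suc i) + loss i)      ≡⟨ *-distribˡ-+ H (S (suc i)) (loss i) ⟩
      H * S (suc i) + H * loss i    ≤⟨ +-monoʳ-≤ (H * S (suc i)) H*loss≤S ⟩
      H * S (suc i) + S i           ∎
      where
      open ≤-Reasoning
      -- For `i < h` truncation gives `i′ = 0`, where `good` is constantly 1, so the first indices
      -- need no separate argument.
      i′ = i ∸ h
      d = i ∸ i′
      i′+d : i′ + d ≡ i
      i′+d = m+[n∸m]≡n (m∸n≤m i h)
      d≤H : d ≤ H
      d≤H = ≤-trans (m≤n+o⇒m∸n≤o i i′ (≤-trans (m≤n+m∸n i h) (≤-reflexive (+-comm h i′)))) h≤k*4
      loss-density : Q * loss i ≤ C * S i′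
      loss-density = ≤-trans
        (*-monoʳ-≤ Q (Σ<-mono (2 ^ T) λ x _ → *-monoˡ-≤ (b i x) (subst (λ y → good y x ≤ good i′ x) i′+d (good-anti-+ i′ d x))))
        (weighted-density T (coarse i) (good i′) (b i) C Q (coarse≤T i i<n)
          (good-block (coarse i) i′ (≤-trans (m∸n≤m i h) (<⇒≤ i<n)) λ j j<i′ →
            nested i j i<n (<⇒≤ (j<i∸h⇒j+h<i j i h j<i′)))
          (dense i i<n))
      -- Returning from `i′` to `i` costs the factor `256/81` of `decay`, and `small` says precisely
      -- that `(C/Q) * H * (256/81) ≤ 1`.
      H*loss≤S : H * loss i ≤ S i
      H*loss≤S = *-cancelˡ-≤ (Q * 81) {{m*n≢0 Q 81}} (begin
        Q * 81 * (H * loss i)     ≡⟨ solve 3 (λ Q H l → Q :* con 81 :* (H :* l) := con 81 :* H :* (Q :* l)) refl Q H (loss i) ⟩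
        81 * H * (Q * loss i)     ≤⟨ *-monoʳ-≤ (81 * H) loss-density ⟩
        81 * H * (C * S i′)       ≡⟨ solve 3 (λ H C s → con 81 :* H :* (C :* s) := C :* H :* (con 81 :* s)) refl H C (S i′) ⟩
        C * H * (81 * S i′)       ≤⟨ *-monoʳ-≤ (C * H) (decay d i′+d d≤H steps) ⟩
        C * H * (256 * S i)       ≡⟨ *-assoc (C * H) 256 (S i) ⟨
        C * H * 256 * S i         ≤⟨ *-monoˡ-≤ (S i) small ⟩
        Q * 81 * S i              ∎)

    all-steps : ∀ i → i ≤ n → ∀ j → j < i → Step j
    all-steps (suc i) i<n j j<1+i =
      [ all-steps i (<⇒≤ i<n) j , (λ { refl → step i i<n (all-steps i (<⇒≤ i<n)) }) ]′ (m≤n⇒m<n∨m≡n (s≤s⁻¹ j<1+i))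

    -- If `S (suc i)` vanished, `Step i` would read `H * S i ≤ S i`, impossible for positive `S i`
    -- since `H ≥ 4`.
    S-pos : ∀ i → i ≤ n → 0 < S i
    S-pos zero    _   = subst (0 <_) (sym (trans (Σ<-const (2 ^ T) 1) (*-identityʳ _))) (m^n>0 2 T)
    S-pos (suc i) i<n = n≢0⇒n>0 λ S≡0 → <⇒≱ (begin-strict
        S i           ≡⟨ sym (*-identityˡ (S i)) ⟩
        1 * S i       <⟨ *-monoˡ-< (S i) {{>-nonZero (S-pos i (<⇒≤ i<n))}} (≤-trans (s≤s (s≤s z≤n)) (*-monoˡ-≤ 4 (>-nonZero⁻¹ k))) ⟩
        H * S i       ∎)
      (subst (H * S i ≤_) (cong (_+ S i) (trans (cong (H *_) S≡0) (*-zeroʳ H))) (all-steps (suc i) i<n i ≤-refl))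
      where open ≤-Reasoning

    survivor : ∃[ x ] (x < 2 ^ T × ∀ i → i < n → b i x ≡ 0)
    survivor = let x , x<2^T , 0<g = Σ<-pos (2 ^ T) (good n) (S-pos n ≤-refl)
               in x , x<2^T , good-nonzero n x 0<g

  -- Bad cells of one integer speed

  f≤Σ< : ∀ n f i → i < n → f i ≤ Σ< n f
  f≤Σ< (suc n) f zero    i<n       = m≤m+n (f 0) _
  f≤Σ< (suc n) f (suc i) (s≤s i<n) = ≤-trans (f≤Σ< n (f ∘ suc) i i<n) (m≤n+m _ (f 0))

  -- Refining the grid by `f` bits repeats every value `2 ^ f` times. Hence a density found at a
  -- speed's own resolution persists on the finest grid, common to all speeds.
  Σ<-≫ : ∀ N f q (g : ℕ → ℕ) →
    Σ< (N * 2 ^ f) (λ r → g ((q * (N * 2 ^ f) + r) ≫ f)) ≡ 2 ^ f * Σ< N (λ r → g (q * N + r))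
  Σ<-≫ N f q g = trans (Σ<-blocks N (2 ^ f) _) (trans
    (Σ<-cong N λ r _ → trans (Σ<-cong (2 ^ f) λ x x<2^f → cong g (index r x x<2^f)) (Σ<-const (2 ^ f) (g (q * N + r))))
    (Σ<-* N (2 ^ f) _))
    where
    index : ∀ r x → x < 2 ^ f → (q * (N * 2 ^ f) + (r * 2 ^ f + x)) ≫ f ≡ q * N + r
    index r x x<2^f = trans
      (cong (_≫ f) (solve 5 (λ q N F r x → q :* (N :* F) :+ (r :* F :+ x) := (q :* N :+ r) :* F :+ x) refl q N (2 ^ f) r x))
      ([q*2^a+r]≫a (q * N + r) f x x<2^f)

  -- The speed v is measured at resolution 2^-l, at which one cell is traversed in about δ = P/Q of a lap.
  module Speed (P Q v m l : ℕ) .{{_ : NonZero Q}} .{{_ : NonZero v}}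
    (v≤2^m : v ≤ 2 ^ m) (2^m<2v : 2 ^ m < 2 * v) (Qv≤P2^l : Q * v ≤ P * 2 ^ l) (m≤l : m ≤ l) where

    -- Lengths on the circle in units of `1/L` of a lap: `L` is the lap, `D` is `δ`, and `V` is the
    -- distance run during one cell. A cell can come within `δ` of the origin if its starting
    -- position lies in `[-(D + V), D]`; adding `D + V` moves this arc to `[0, 2D + V]`.
    V D L : ℕ
    V = Q * v
    D = P * 2 ^ l
    L = Q * 2 ^ l

    instance
      L≢0 : NonZero L
      L≢0 = m*n≢0 Q (2 ^ l) {{it}} {{m^n≢0 2 l}}
      V≢0 : NonZero V
      V≢0 = m*n≢0 Q v

    -- The cell [c/2^l, (c+1)/2^l] may contain a time at which the runner is within δ of the origin.
    bad : ℕ → ℕ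
    bad c = 𝟙 ((c * V + (D + V)) % L ≤? (2 * D + V))

    -- The block lasts `1 / 2 ^ m ≤ 1/v`, at most one lap, so `arc-count` applies. Its bound
    -- `2D + 3V` is at most `5D` because `V ≤ D`, and `2 ^ m < 2 * v` turns 5 into 10.
    bad-count : ∀ q → Q * Σ< (2 ^ (l ∸ m)) (λ r → bad (q * 2 ^ (l ∸ m) + r)) ≤ 10 * P * 2 ^ (l ∸ m)
    bad-count q = *-cancelˡ-≤ v (begin
      v * (Q * count)            ≡⟨ solve 3 (λ v Q c → v :* (Q :* c) := Q :* v :* c) refl v Q count ⟩
      V * count                  ≡⟨ cong (V *_) (Σ<-cong N λ r _ → cong (λ y → 𝟙 (y % L ≤? (2 * D + V))) (shift r)) ⟩
      V * Σ< N (λ r → 𝟙 ((q * N * V + (D + V) + r * V) % L ≤? (2 * D + V)))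
                                 ≤⟨ arc-count N V (q * N * V + (D + V)) L (2 * D + V) N*V≤L ⟩
      2 * D + V + 2 * V          ≤⟨ +-mono-≤ (+-monoʳ-≤ (2 * D) Qv≤P2^l) (*-monoʳ-≤ 2 Qv≤P2^l) ⟩
      2 * D + D + 2 * D          ≡⟨ cong (λ x → 2 * (P * x) + P * x + 2 * (P * x)) 2^l ⟩
      2 * (P * (N * 2 ^ m)) + P * (N * 2 ^ m) + 2 * (P * (N * 2 ^ m))
                                 ≡⟨ solve 3 (λ P N M → con 2 :* (P :* (N :* M)) :+ P :* (N :* M) :+ con 2 :* (P :* (N :* M)) := con 5 :* P :* N :* M) refl P N (2 ^ m) ⟩
      5 * P * N * 2 ^ m          ≤⟨ *-monoʳ-≤ (5 * P * N) (<⇒≤ 2^m<2v) ⟩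
      5 * P * N * (2 * v)        ≡⟨ solve 3 (λ P N v → con 5 :* P :* N :* (con 2 :* v) := v :* (con 10 :* P :* N)) refl P N v ⟩
      v * (10 * P * N)           ∎)
      where
      open ≤-Reasoning
      N = 2 ^ (l ∸ m)
      count = Σ< N (λ r → bad (q * N + r))
      2^l : 2 ^ l ≡ N * 2 ^ m
      2^l = trans (cong (2 ^_) (sym (m∸n+n≡m m≤l))) (^-distribˡ-+-* 2 (l ∸ m) m)
      shift : ∀ r → (q * N + r) * V + (D + V) ≡ q * N * V + (D + V) + r * V
      shift r = solve 5 (λ q N r V D → (q :* N :+ r) :* V :+ (D :+ V) := q :* N :* V :+ (D :+ V) :+ r :* V) refl q N r V D
      N*V≤L : N * V ≤ L
      N*V≤L = begin
        N * (Q * v)       ≤⟨ *-monoʳ-≤ N (*-monoʳ-≤ Q v≤2^m) ⟩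
        N * (Q * 2 ^ m)   ≡⟨ solve 3 (λ N Q M → N :* (Q :* M) := Q :* (N :* M)) refl N Q (2 ^ m) ⟩
        Q * (N * 2 ^ m)   ≡⟨ cong (Q *_) 2^l ⟨
        Q * 2 ^ l         ∎

    bad-density : ∀ f q → Q * Σ< (2 ^ (l ∸ m + f)) (λ r → bad ((q * 2 ^ (l ∸ m + f) + r) ≫ f)) ≤ 10 * P * 2 ^ (l ∸ m + f)
    bad-density f q rewrite ^-distribˡ-+-* 2 (l ∸ m) f | Σ<-≫ (2 ^ (l ∸ m)) f q bad = begin
      Q * (2 ^ f * count)            ≡⟨ solve 3 (λ Q F c → Q :* (F :* c) := Q :* c :* F) refl Q (2 ^ f) count ⟩
      Q * count * 2 ^ f              ≤⟨ *-monoˡ-≤ (2 ^ f) (bad-count q) ⟩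
      10 * P * 2 ^ (l ∸ m) * 2 ^ f   ≡⟨ *-assoc (10 * P) (2 ^ (l ∸ m)) (2 ^ f) ⟩
      10 * P * (2 ^ (l ∸ m) * 2 ^ f) ∎
      where
      open ≤-Reasoning
      count = Σ< (2 ^ (l ∸ m)) (λ r → bad (q * 2 ^ (l ∸ m) + r))

    -- The time is `x / 2 ^ (l + f)`, a point of the cell `x ≫ f`. A shifted residue above `2D + V`
    -- puts the start of the cell beyond `z + δ`, and a residue below `L` puts its end before
    -- `z + 1 - δ`; the runner is in between.
    not-bad : ∀ f x → bad (x ≫ f) ≡ 0 →
      ∃[ z ] ((z * Q + P) * 2 ^ (l + f) ≤ Q * (x * v) × Q * (x * v) + P * 2 ^ (l + f) ≤ suc z * Q * 2 ^ (l + f))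
    not-bad f x b≡0 = z , lower , upper
      where
      open ≤-Reasoning
      F = 2 ^ f
      c = x ≫ f
      y = c * V + (D + V)
      z = y / L
      ρ = y % L
      y≡ : y ≡ ρ + z * L
      y≡ = m≡m%n+[m/n]*n y L
      A<ρ : 2 * D + V < ρ
      A<ρ = ≰⇒> (𝟙≡0 (ρ ≤? (2 * D + V)) b≡0)
      zL+D≤cV : z * L + D ≤ c * V
      zL+D≤cV = +-cancelʳ-≤ (D + V) _ _ (begin
        z * L + D + (D + V)   ≡⟨ solve 3 (λ z d v → z :+ d :+ (d :+ v) := con 2 :* d :+ v :+ z) refl (z * L) D V ⟩
        2 * D + V + z * L     ≤⟨ +-monoˡ-≤ (z * L) (<⇒≤ A<ρ) ⟩
        ρ + z * L             ≡⟨ y≡ ⟨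
        c * V + (D + V)       ∎)
      c*F≤x : c * F ≤ x
      c*F≤x = m/n*n≤m x F {{m^n≢0 2 f}}
      x≤[1+c]*F : x ≤ suc c * F
      x≤[1+c]*F = begin
        x                              ≡⟨ m≡m%n+[m/n]*n x F {{m^n≢0 2 f}} ⟩
        _%_ x F {{m^n≢0 2 f}} + c * F  ≤⟨ +-monoˡ-≤ (c * F) (<⇒≤ (m%n<n x F {{m^n≢0 2 f}})) ⟩
        suc c * F                      ∎
      lower : (z * Q + P) * 2 ^ (l + f) ≤ Q * (x * v)
      lower = begin
        (z * Q + P) * 2 ^ (l + f)   ≡⟨ cong ((z * Q + P) *_) (^-distribˡ-+-* 2 l f) ⟩
        (z * Q + P) * (2 ^ l * F)   ≡⟨ solve 5 (λ z Q P M F → (z :* Q :+ P) :* (M :* F) := (z :* (Q :* M) :+ P :* M) :* F) refl z Q P (2 ^ l) F ⟩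
        (z * L + D) * F             ≤⟨ *-monoˡ-≤ F zL+D≤cV ⟩
        c * V * F                   ≡⟨ solve 4 (λ c Q v F → c :* (Q :* v) :* F := Q :* (c :* F :* v)) refl c Q v F ⟩
        Q * (c * F * v)             ≤⟨ *-monoʳ-≤ Q (*-monoˡ-≤ v c*F≤x) ⟩
        Q * (x * v)                 ∎
      upper : Q * (x * v) + P * 2 ^ (l + f) ≤ suc z * Q * 2 ^ (l + f)
      upper = begin
        Q * (x * v) + P * 2 ^ (l + f)          ≤⟨ +-monoˡ-≤ (P * 2 ^ (l + f)) (*-monoʳ-≤ Q (*-monoˡ-≤ v x≤[1+c]*F)) ⟩
        Q * (suc c * F * v) + P * 2 ^ (l + f)  ≡⟨ cong (λ w → Q * (suc c * F * v) + P * w) (^-distribˡ-+-* 2 l f) ⟩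
        Q * (suc c * F * v) + P * (2 ^ l * F)
          ≡⟨ solve 6 (λ c Q v P M F → Q :* ((con 1 :+ c) :* F :* v) :+ P :* (M :* F) := (c :* (Q :* v) :+ (P :* M :+ Q :* v)) :* F) refl c Q v P (2 ^ l) F ⟩
        y * F                                  ≡⟨ cong (_* F) y≡ ⟩
        (ρ + z * L) * F                        ≤⟨ *-monoˡ-≤ F (+-monoˡ-≤ (z * L) (<⇒≤ (m%n<n y L))) ⟩
        suc z * L * F                          ≡⟨ solve 4 (λ z Q M F → (con 1 :+ z) :* (Q :* M) :* F := (con 1 :+ z) :* Q :* (M :* F)) refl z Q (2 ^ l) F ⟩
        suc z * Q * (2 ^ l * F)                ≡⟨ cong (suc z * Q *_) (^-distribˡ-+-* 2 l f) ⟨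
        suc z * Q * 2 ^ (l + f)                ∎

  -- All integer speeds together

  2^-cancel-≤ : ∀ a b → 2 ^ a < 2 * 2 ^ b → a ≤ b
  2^-cancel-≤ a b 2^a<2^1+b with a ≤? b
  ... | yes a≤b = a≤b
  ... | no a≰b  = contradiction (^-monoʳ-≤ 2 (≰⇒> a≰b)) (<⇒≱ 2^a<2^1+b)

  module Integral (n h P Q : ℕ) .{{_ : NonZero Q}} .{{_ : NonZero P}}
    (P-small : P * 10240 ≤ Q) (hP-small : h * P * 32 ≤ Q)
    (v : ℕ → ℕ) (v≥1 : ∀ i → 1 ≤ v i) (v₀≤v : ∀ i → v 0 ≤ v i)
    (gap : ∀ i j → i < n → j + h ≤ i → Q * v j ≤ P * v i) where

    open ≤-Reasoning

    1≤P : 1 ≤ P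
    1≤P = >-nonZero⁻¹ P

    2P≤Q : 2 * P ≤ Q
    2P≤Q = ≤-trans (≤-trans (≤-reflexive (*-comm 2 P)) (*-monoʳ-≤ P (≤ᵇ⇒≤ 2 10240 _))) P-small

    P≤Qv : ∀ i → P ≤ Q * v i
    P≤Qv i = begin
      P         ≤⟨ m≤m+n P (P + 0) ⟩
      2 * P     ≤⟨ 2P≤Q ⟩
      Q         ≡⟨ *-identityʳ Q ⟨
      Q * 1     ≤⟨ *-monoʳ-≤ Q (v≥1 i) ⟩
      Q * v i   ∎

    m l : ℕ → ℕ
    m i = proj₁ (dyadic-scale 1 (v i) ≤-refl (v≥1 i))
    l i = proj₁ (dyadic-scale P (Q * v i) 1≤P (P≤Qv i))

    v≤2^m : ∀ i → v i ≤ 2 ^ m i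
    v≤2^m i = subst (v i ≤_) (*-identityˡ _) (proj₁ (proj₂ (dyadic-scale 1 (v i) ≤-refl (v≥1 i))))

    2^m<2v : ∀ i → 2 ^ m i < 2 * v i
    2^m<2v i = subst (_< 2 * v i) (*-identityˡ _) (proj₂ (proj₂ (dyadic-scale 1 (v i) ≤-refl (v≥1 i))))

    Qv≤P2^l : ∀ i → Q * v i ≤ P * 2 ^ l i
    Qv≤P2^l i = proj₁ (proj₂ (dyadic-scale P (Q * v i) 1≤P (P≤Qv i)))

    P2^l<2Qv : ∀ i → P * 2 ^ l i < 2 * (Q * v i)
    P2^l<2Qv i = proj₂ (proj₂ (dyadic-scale P (Q * v i) 1≤P (P≤Qv i)))

    m≤l : ∀ i → m i ≤ l i
    m≤l i = 2^-cancel-≤ (m i) (l i) (<-≤-trans (2^m<2v i) (*-monoʳ-≤ 2 (*-cancelˡ-≤ P (begin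
      P * v i        ≤⟨ *-monoˡ-≤ (v i) (≤-trans (m≤m+n P (P + 0)) 2P≤Q) ⟩
      Q * v i        ≤⟨ Qv≤P2^l i ⟩
      P * 2 ^ l i    ∎))))

    m₀≤m : ∀ i → m 0 ≤ m i
    m₀≤m i = 2^-cancel-≤ (m 0) (m i) (<-≤-trans (2^m<2v 0) (*-monoʳ-≤ 2 (≤-trans (v₀≤v i) (v≤2^m i))))

    -- The gap makes a cell of speed `j` at least as long as a density block of speed `i`. Rounding
    -- up to powers of two loses a factor strictly below 2, which the comparison of integer
    -- exponents absorbs.
    l≤m : ∀ i j → i < n → j + h ≤ i → l j ≤ m i
    l≤m i j i<n j+h≤i = 2^-cancel-≤ (l j) (m i) (*-cancelˡ-< P _ _ (begin-strict
      P * 2 ^ l j          <⟨ P2^l<2Qv j ⟩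
      2 * (Q * v j)        ≤⟨ *-monoʳ-≤ 2 (gap i j i<n j+h≤i) ⟩
      2 * (P * v i)        ≤⟨ *-monoʳ-≤ 2 (*-monoʳ-≤ P (v≤2^m i)) ⟩
      2 * (P * 2 ^ m i)    ≡⟨ solve 2 (λ p x → con 2 :* (p :* x) := p :* (con 2 :* x)) refl P (2 ^ m i) ⟩
      P * (2 * 2 ^ m i)    ∎))

    -- `1 / 2 ^ K` is a common finest resolution; the sum serves as an upper bound for all `l i`.
    -- `k * 4` is the least multiple of 4 strictly above `h`, hence positive even for `h = 0`.
    K k : ℕ
    K = m 0 + Σ< n l
    k = suc (h / 4)

    l≤K : ∀ i → i < n → l i ≤ K
    l≤K i i<n = ≤-trans (f≤Σ< n l i i<n) (m≤n+m (Σ< n l) (m 0))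

    module At i = Speed P Q (v i) (m i) (l i) {{it}} {{>-nonZero (v≥1 i)}} (v≤2^m i) (2^m<2v i) (Qv≤P2^l i) (m≤l i)

    k*4≤4+h : k * 4 ≤ 4 + h
    k*4≤4+h = +-monoʳ-≤ 4 (m/n*n≤m h 4)

    h≤k*4 : h ≤ k * 4
    h≤k*4 = begin
      h                   ≡⟨ m≡m%n+[m/n]*n h 4 ⟩
      h % 4 + h / 4 * 4   ≤⟨ +-monoˡ-≤ (h / 4 * 4) (<⇒≤ (m%n<n h 4)) ⟩
      k * 4               ∎

    -- Rounding `h` up costs at most `10 * 4 * 256 = 10240` copies of `P`, that is one `Q`; the
    -- remaining `2560 = 32 * 80` copies of `h * P` cost at most `80` more.
    small : 10 * P * (k * 4) * 256 ≤ Q * 81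
    small = begin
      10 * P * (k * 4) * 256       ≤⟨ *-monoˡ-≤ 256 (*-monoʳ-≤ (10 * P) k*4≤4+h) ⟩
      10 * P * (4 + h) * 256       ≡⟨ solve 2 (λ P h → con 10 :* P :* (con 4 :+ h) :* con 256 := P :* con 10240 :+ h :* P :* con 32 :* con 80) refl P h ⟩
      P * 10240 + h * P * 32 * 80  ≤⟨ +-mono-≤ P-small (*-monoˡ-≤ 80 hP-small) ⟩
      Q + Q * 80                   ≡⟨ *-suc Q 80 ⟨
      Q * 81                       ∎

    coarse-split : ∀ i → i < n → l i ∸ m i + (K ∸ l i) ≡ K ∸ m i
    coarse-split i i<n = trans (sym (+-∸-comm (K ∸ l i) (m≤l i))) (cong (_∸ m i) (m+[n∸m]≡n (l≤K i i<n)))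

    -- The `2 ^ (K ∸ m 0)` grid points span a time `1 / 2 ^ m 0`. This is at most `1 / v 0`, yet no
    -- shorter than the density block of any speed, as `m 0 ≤ m i`.
    open Sieve n h (K ∸ m 0) (10 * P) Q k
      (λ i x → At.bad i (x ≫ (K ∸ l i))) (λ i → K ∸ m i) (λ i → K ∸ l i)
      h≤k*4 small
      (λ i _ → ∸-monoʳ-≤ K (m₀≤m i))
      (λ i j i<n j+h≤i → ∸-monoʳ-≤ K (l≤m i j i<n j+h≤i))
      (λ i _ x y eq → cong (At.bad i) eq)
      (λ i i<n q → subst (λ a → Q * Σ< (2 ^ a) (λ r → At.bad i ((q * 2 ^ a + r) ≫ (K ∸ l i))) ≤ 10 * P * 2 ^ a)
        (coarse-split i i<n) (At.bad-density i (K ∸ l i) q))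
      using (survivor)

    lonely-time : ∃[ x ] (x * v 0 ≤ 2 ^ K × ∀ i → i < n →
      ∃[ z ] ((z * Q + P) * 2 ^ K ≤ Q * (x * v i) × Q * (x * v i) + P * 2 ^ K ≤ suc z * Q * 2 ^ K))
    lonely-time = let x , x<2^T , good = survivor in
      x ,
      (begin
        x * v 0                    ≤⟨ *-mono-≤ (<⇒≤ x<2^T) (v≤2^m 0) ⟩
        2 ^ (K ∸ m 0) * 2 ^ m 0    ≡⟨ ^-distribˡ-+-* 2 (K ∸ m 0) (m 0) ⟨
        2 ^ (K ∸ m 0 + m 0)        ≡⟨ cong (2 ^_) (m∸n+n≡m (m≤m+n (m 0) (Σ< n l))) ⟩
        2 ^ K                      ∎) ,
      λ i i<n → subst
        (λ e → ∃[ z ] ((z * Q + P) * 2 ^ e ≤ Q * (x * v i) × Q * (x * v i) + P * 2 ^ e ≤ suc z * Q * 2 ^ e))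
        (m+[n∸m]≡n (l≤K i i<n)) (At.not-bad i (K ∸ l i) x (good i i<n))

open import Defs
open import Data.Fin.Base as Fin using (Fin; toℕ; fromℕ<)
import Data.Fin.Properties as Fin
open import Data.Integer.Base as ℤ using (ℤ; +_; +[1+_]; -[1+_])
import Data.Integer.Properties as ℤ
open import Data.Nat.Base as ℕ using (ℕ; zero; suc; NonZero)
import Data.Nat.Properties as ℕ
open import Data.Product.Base using (∃-syntax; Σ-syntax; _×_; _,_; proj₁; proj₂)
open import Data.Rational.Base as ℚ using (ℚ; mkℚ; 0ℚ; 1ℚ; ½; *<*; *≤*; ∣_∣)
open import Data.Rational.Literals using (fromℤ)
import Data.Rational.Properties as ℚ
open import Data.Rational.Solver using () renaming (module +-*-Solver to ℚ-Solver)
import Data.Rational.Unnormalised.Base as ℚᵘ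
import Data.Rational.Unnormalised.Properties as ℚᵘ
open import Data.Sum.Base using (inj₁; inj₂)
open import Function.Base using (_∘_)
open import Relation.Binary.PropositionalEquality using (_≡_; refl; sym; trans; cong; cong₂; subst; subst₂; module ≡-Reasoning)
open import Relation.Nullary using (Dec; yes; no; contradiction)
open IntegerSpeeds using (module Integral)

-- Rational speeds

fromℤ-+ : ∀ i j → fromℤ (i ℤ.+ j) ≡ fromℤ i ℚ.+ fromℤ j
fromℤ-+ i j = ℚ.toℚᵘ-injective (ℚᵘ.≃-sym (ℚᵘ.≃-trans (ℚ.toℚᵘ-homo-+ (fromℤ i) (fromℤ j))
  (ℚᵘ.*≡* (cong (ℤ._* + 1) (cong₂ ℤ._+_ (ℤ.*-identityʳ i) (ℤ.*-identityʳ j))))))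

fromℤ-* : ∀ i j → fromℤ (i ℤ.* j) ≡ fromℤ i ℚ.* fromℤ j
fromℤ-* i j = ℚ.toℚᵘ-injective (ℚᵘ.≃-sym (ℚᵘ.≃-trans (ℚ.toℚᵘ-homo-* (fromℤ i) (fromℤ j)) (ℚᵘ.*≡* refl)))

fromℤ-mono-≤ : ∀ {i j} → i ℤ.≤ j → fromℤ i ℚ.≤ fromℤ j
fromℤ-mono-≤ i≤j = *≤* (ℤ.*-monoʳ-≤-nonNeg (+ 1) i≤j)

ι : ℕ → ℚ
ι n = fromℤ (+ n)

ι-+ : ∀ m n → ι (m ℕ.+ n) ≡ ι m ℚ.+ ι n
ι-+ m n = fromℤ-+ (+ m) (+ n)

ι-* : ∀ m n → ι (m ℕ.* n) ≡ ι m ℚ.* ι n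
ι-* m n = trans (cong fromℤ (ℤ.pos-* m n)) (fromℤ-* (+ m) (+ n))

ι-mono-≤ : ∀ {m n} → m ℕ.≤ n → ι m ℚ.≤ ι n
ι-mono-≤ m≤n = fromℤ-mono-≤ (ℤ.+≤+ m≤n)

ι-cancel-≤ : ∀ {m n} → ι m ℚ.≤ ι n → m ℕ.≤ n
ι-cancel-≤ {m} {n} (*≤* le) = ℤ.drop‿+≤+ (subst₂ ℤ._≤_ (ℤ.*-identityʳ (+ m)) (ℤ.*-identityʳ (+ n)) le)

ι-nonNeg : ∀ n → 0ℚ ℚ.≤ ι n
ι-nonNeg n = ι-mono-≤ ℕ.z≤n

ι-pos : ∀ n → 1 ℕ.≤ n → 0ℚ ℚ.< ι n
ι-pos n 1≤n = ℚ.<-≤-trans (ℚ.positive⁻¹ 1ℚ) (ι-mono-≤ 1≤n)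

*-monoˡ : ∀ {r p q} → 0ℚ ℚ.≤ r → p ℚ.≤ q → r ℚ.* p ℚ.≤ r ℚ.* q
*-monoˡ {r} 0≤r = ℚ.*-monoˡ-≤-nonNeg r {{ℚ.nonNegative 0≤r}}

*-monoʳ : ∀ {r p q} → 0ℚ ℚ.≤ r → p ℚ.≤ q → p ℚ.* r ℚ.≤ q ℚ.* r
*-monoʳ {r} 0≤r = ℚ.*-monoʳ-≤-nonNeg r {{ℚ.nonNegative 0≤r}}

*-cancelˡ : ∀ {r p q} → 0ℚ ℚ.< r → r ℚ.* p ℚ.≤ r ℚ.* q → p ℚ.≤ q
*-cancelˡ {r} 0<r = ℚ.*-cancelˡ-≤-pos r {{ℚ.positive 0<r}}

*-positive : ∀ {p q} → 0ℚ ℚ.< p → 0ℚ ℚ.< q → 0ℚ ℚ.< p ℚ.* q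
*-positive {p} {q} 0<p 0<q = subst (ℚ._< p ℚ.* q) (ℚ.*-zeroʳ p) (ℚ.*-monoʳ-<-pos p {{ℚ.positive 0<p}} 0<q)

*-nonNegative : ∀ {p q} → 0ℚ ℚ.≤ p → 0ℚ ℚ.≤ q → 0ℚ ℚ.≤ p ℚ.* q
*-nonNegative {p} {q} 0≤p 0≤q = subst (ℚ._≤ p ℚ.* q) (ℚ.*-zeroʳ p) (*-monoˡ 0≤p 0≤q)

clear-denominator : ∀ p → 0ℚ ℚ.< p → ∃[ d ] ∃[ a ] (1 ℕ.≤ d × 1 ℕ.≤ a × ι d ℚ.* p ≡ ι a)
clear-denominator (mkℚ (+ 0) _ _) (*<* (ℤ.+<+ ()))
clear-denominator (mkℚ (-[1+ _ ]) _ _) (*<* ())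
clear-denominator p@(mkℚ +[1+ a ] d _) _ = suc d , suc a , ℕ.s≤s ℕ.z≤n , ℕ.s≤s ℕ.z≤n ,
  ℚ.toℚᵘ-injective (ℚᵘ.≃-trans (ℚ.toℚᵘ-homo-* (ι (suc d)) p)
    (ℚᵘ.*≡* (trans (ℤ.*-identityʳ _) (trans (ℤ.*-comm (+ suc d) +[1+ a ]) (cong (λ x → +[1+ a ] ℤ.* + suc x) (sym (ℕ.+-identityʳ d)))))))

common-denominator : ∀ n (u : Fin n → ℚ) → (∀ i → 0ℚ ℚ.< u i) →
  ∃[ D ] Σ[ A ∈ (Fin n → ℕ) ] (1 ℕ.≤ D × (∀ i → 1 ℕ.≤ A i) × ∀ i → ι D ℚ.* u i ≡ ι (A i))
common-denominator zero    u 0<u = 1 , (λ ()) , ℕ.≤-refl , (λ ()) , λ ()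
common-denominator (suc n) u 0<u
  with clear-denominator (u Fin.zero) (0<u Fin.zero) | common-denominator n (u ∘ Fin.suc) (0<u ∘ Fin.suc)
... | d , a , 1≤d , 1≤a , du≡a | D , A , 1≤D , 1≤A , Du≡A =
  d ℕ.* D , B , ℕ.*-mono-≤ 1≤d 1≤D , 1≤B , B-eq
  where
  open ℚ-Solver
  B : Fin (suc n) → ℕ
  B Fin.zero    = D ℕ.* a
  B (Fin.suc i) = d ℕ.* A i
  1≤B : ∀ i → 1 ℕ.≤ B i
  1≤B Fin.zero    = ℕ.*-mono-≤ 1≤D 1≤a
  1≤B (Fin.suc i) = ℕ.*-mono-≤ 1≤d (1≤A i)
  B-eq : ∀ i → ι (d ℕ.* D) ℚ.* u i ≡ ι (B i)
  B-eq Fin.zero = trans (cong (ℚ._* u Fin.zero) (ι-* d D))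
    (trans (solve 3 (λ d D u → d :* D :* u := D :* (d :* u)) refl (ι d) (ι D) (u Fin.zero))
    (trans (cong (ι D ℚ.*_) du≡a) (sym (ι-* D a))))
  B-eq (Fin.suc i) = trans (cong (ℚ._* u (Fin.suc i)) (ι-* d D))
    (trans (ℚ.*-assoc (ι d) (ι D) (u (Fin.suc i)))
    (trans (cong (ι d ℚ.*_) (Du≡A i)) (sym (ι-* d (A i)))))

-- `Integral` takes speeds indexed by all of ℕ. The default `f zero` keeps them positive and at
-- least the first speed.
extend : ∀ {n} → (Fin (suc n) → ℕ) → ℕ → ℕ
extend {n} f i with i ℕ.<? suc n
... | yes i<n = f (fromℕ< i<n)
... | no _    = f Fin.zero

extend-all : ∀ {n} (f : Fin (suc n) → ℕ) (Φ : ℕ → Set) → (∀ i → Φ (f i)) → ∀ i → Φ (extend f i)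
extend-all {n} f Φ Φf i with i ℕ.<? suc n
... | yes i<n = Φf (fromℕ< i<n)
... | no _    = Φf Fin.zero

extend-fromℕ< : ∀ {n} (f : Fin (suc n) → ℕ) i (i<n : i ℕ.< suc n) → extend f i ≡ f (fromℕ< i<n)
extend-fromℕ< {n} f i i<n with i ℕ.<? suc n
... | yes _  = refl
... | no i≮n = contradiction i<n i≮n

extend-toℕ : ∀ {n} (f : Fin (suc n) → ℕ) i → extend f (toℕ i) ≡ f i
extend-toℕ f i = trans (extend-fromℕ< f (toℕ i) (Fin.toℕ<n i)) (cong f (Fin.fromℕ<-toℕ i (Fin.toℕ<n i)))

-- With `δ = P/Q` and `D * u i = A i`, a time `x / E` for the integer speeds `A i` becomes the time
-- `D * x / E` for the speeds `u i`; positions on the circle, and so `δ`, are unchanged.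
rational-lonely-time : ∀ n h (δ : ℚ) (u : Fin (suc n) → ℚ) → 0ℚ ℚ.< δ → (∀ i → 0ℚ ℚ.< u i) →
  δ ℚ.* ι 10240 ℚ.≤ 1ℚ → ι h ℚ.* δ ℚ.* ι 32 ℚ.≤ 1ℚ →
  (∀ i → u Fin.zero ℚ.≤ u i) →
  (∀ i j → toℕ i ℕ.+ h ℕ.≤ toℕ j → u i ℚ.≤ δ ℚ.* u j) →
  ∃[ τ ] (0ℚ ℚ.≤ τ × τ ℚ.* u Fin.zero ℚ.≤ 1ℚ ×
    ∀ i → ∃[ z ] (ι z ℚ.+ δ ℚ.≤ τ ℚ.* u i × τ ℚ.* u i ℚ.+ δ ℚ.≤ ι (suc z)))
rational-lonely-time n h δ u 0<δ 0<u δ-small hδ-small u₀≤u gap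
  with clear-denominator δ 0<δ | common-denominator (suc n) u 0<u
... | Q , P , 1≤Q , 1≤P , Qδ≡P | D , A , 1≤D , 1≤A , Du≡A =
  τ , 0≤τ , τu₀≤1 , λ i → bounds i (proj₂ (proj₂ lonely-time) (toℕ i) (Fin.toℕ<n i))
  where
  open ℚ-Solver
  instance
    Q≢0 : NonZero Q
    Q≢0 = ℕ.>-nonZero 1≤Q
    P≢0 : NonZero P
    P≢0 = ℕ.>-nonZero 1≤P
  0<Q = ι-pos Q 1≤Q
  0<D = ι-pos D 1≤D
  v = extend A

  P-small : P ℕ.* 10240 ℕ.≤ Q
  P-small = ι-cancel-≤ (begin
    ι (P ℕ.* 10240)               ≡⟨ ι-* P 10240 ⟩
    ι P ℚ.* ι 10240               ≡⟨ cong (ℚ._* ι 10240) Qδ≡P ⟨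
    ι Q ℚ.* δ ℚ.* ι 10240         ≡⟨ ℚ.*-assoc (ι Q) δ (ι 10240) ⟩
    ι Q ℚ.* (δ ℚ.* ι 10240)       ≤⟨ *-monoˡ (ι-nonNeg Q) δ-small ⟩
    ι Q ℚ.* 1ℚ                    ≡⟨ ℚ.*-identityʳ (ι Q) ⟩
    ι Q                           ∎)
    where open ℚ.≤-Reasoning

  hP-small : h ℕ.* P ℕ.* 32 ℕ.≤ Q
  hP-small = ι-cancel-≤ (begin
    ι (h ℕ.* P ℕ.* 32)            ≡⟨ trans (ι-* (h ℕ.* P) 32) (cong (ℚ._* ι 32) (ι-* h P)) ⟩
    ι h ℚ.* ι P ℚ.* ι 32          ≡⟨ cong (λ p → ι h ℚ.* p ℚ.* ι 32) Qδ≡P ⟨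
    ι h ℚ.* (ι Q ℚ.* δ) ℚ.* ι 32  ≡⟨ solve 4 (λ h q d c → h :* (q :* d) :* c := q :* (h :* d :* c)) refl (ι h) (ι Q) δ (ι 32) ⟩
    ι Q ℚ.* (ι h ℚ.* δ ℚ.* ι 32)  ≤⟨ *-monoˡ (ι-nonNeg Q) hδ-small ⟩
    ι Q ℚ.* 1ℚ                    ≡⟨ ℚ.*-identityʳ (ι Q) ⟩
    ι Q                           ∎)
    where open ℚ.≤-Reasoning

  A₀≤A : ∀ i → A Fin.zero ℕ.≤ A i
  A₀≤A i = ι-cancel-≤ (subst₂ ℚ._≤_ (Du≡A Fin.zero) (Du≡A i) (*-monoˡ (ι-nonNeg D) (u₀≤u i)))

  A-gap : ∀ i j → toℕ i ℕ.+ h ℕ.≤ toℕ j → Q ℕ.* A i ℕ.≤ P ℕ.* A j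
  A-gap i j i+h≤j = ι-cancel-≤ (begin
    ι (Q ℕ.* A i)                   ≡⟨ trans (ι-* Q (A i)) (cong (ι Q ℚ.*_) (sym (Du≡A i))) ⟩
    ι Q ℚ.* (ι D ℚ.* u i)           ≤⟨ *-monoˡ (ι-nonNeg Q) (*-monoˡ (ι-nonNeg D) (gap i j i+h≤j)) ⟩
    ι Q ℚ.* (ι D ℚ.* (δ ℚ.* u j))   ≡⟨ solve 4 (λ q d e u → q :* (d :* (e :* u)) := (q :* e) :* (d :* u)) refl (ι Q) (ι D) δ (u j) ⟩
    ι Q ℚ.* δ ℚ.* (ι D ℚ.* u j)     ≡⟨ trans (cong₂ ℚ._*_ Qδ≡P (Du≡A j)) (sym (ι-* P (A j))) ⟩
    ι (P ℕ.* A j)                   ∎)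
    where open ℚ.≤-Reasoning

  v-gap : ∀ i j → i ℕ.< suc n → j ℕ.+ h ℕ.≤ i → Q ℕ.* v j ℕ.≤ P ℕ.* v i
  v-gap i j i<n j+h≤i = subst₂ (λ a b → Q ℕ.* a ℕ.≤ P ℕ.* b)
    (sym (extend-fromℕ< A j j<n)) (sym (extend-fromℕ< A i i<n))
    (A-gap (fromℕ< j<n) (fromℕ< i<n)
      (subst₂ (λ a b → a ℕ.+ h ℕ.≤ b) (sym (Fin.toℕ-fromℕ< j<n)) (sym (Fin.toℕ-fromℕ< i<n)) j+h≤i))
    where
    j<n : j ℕ.< suc n
    j<n = ℕ.≤-<-trans (ℕ.≤-trans (ℕ.m≤m+n j h) j+h≤i) i<n

  open Integral (suc n) h P Q P-small hP-small v
    (extend-all A (1 ℕ.≤_) 1≤A)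
    (extend-all A (v 0 ℕ.≤_) A₀≤A)
    v-gap using (lonely-time; K)

  E x : ℕ
  E = 2 ℕ.^ K
  x = proj₁ lonely-time

  1≤E : 1 ℕ.≤ E
  1≤E = ℕ.m^n>0 2 K

  0<E = ι-pos E 1≤E

  τ : ℚ
  τ = ι x ℚ.* ι D ℚ.* invℚ (ι E)

  0≤τ : 0ℚ ℚ.≤ τ
  0≤τ = *-nonNegative (*-nonNegative (ι-nonNeg x) (ι-nonNeg D)) (ℚ.<⇒≤ (invℚ-pos 0<E))

  E*τu : ∀ i → ι E ℚ.* (τ ℚ.* u i) ≡ ι (x ℕ.* A i)
  E*τu i = begin
    ι E ℚ.* (ι x ℚ.* ι D ℚ.* invℚ (ι E) ℚ.* u i)
      ≡⟨ solve 5 (λ e x d i u → e :* (x :* d :* i :* u) := (i :* e) :* (x :* (d :* u))) refl (ι E) (ι x) (ι D) (invℚ (ι E)) (u i) ⟩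
    (invℚ (ι E) ℚ.* ι E) ℚ.* (ι x ℚ.* (ι D ℚ.* u i))
      ≡⟨ cong₂ (λ a b → a ℚ.* (ι x ℚ.* b)) (invℚ-inverse 0<E) (Du≡A i) ⟩
    1ℚ ℚ.* (ι x ℚ.* ι (A i)) ≡⟨ ℚ.*-identityˡ _ ⟩
    ι x ℚ.* ι (A i) ≡⟨ ι-* x (A i) ⟨
    ι (x ℕ.* A i) ∎
    where open ≡-Reasoning

  τu₀≤1 : τ ℚ.* u Fin.zero ℚ.≤ 1ℚ
  τu₀≤1 = *-cancelˡ 0<E (subst₂ ℚ._≤_ (sym (E*τu Fin.zero)) (sym (ℚ.*-identityʳ (ι E)))
    (ι-mono-≤ (proj₁ (proj₂ lonely-time))))

  0<QE = *-positive 0<Q 0<E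

  QE*τu : ∀ i → ι Q ℚ.* ι E ℚ.* (τ ℚ.* u i) ≡ ι (Q ℕ.* (x ℕ.* A i))
  QE*τu i = trans (ℚ.*-assoc (ι Q) (ι E) (τ ℚ.* u i)) (trans (cong (ι Q ℚ.*_) (E*τu i)) (sym (ι-* Q (x ℕ.* A i))))

  QE*δ : ι Q ℚ.* ι E ℚ.* δ ≡ ι (P ℕ.* E)
  QE*δ = trans (solve 3 (λ q e d → q :* e :* d := q :* d :* e) refl (ι Q) (ι E) δ)
    (trans (cong (ℚ._* ι E) Qδ≡P) (sym (ι-* P E)))

  QE*ι : ∀ z → ι Q ℚ.* ι E ℚ.* ι z ≡ ι (z ℕ.* Q ℕ.* E)
  QE*ι z = trans (solve 3 (λ q e z → q :* e :* z := z :* q :* e) refl (ι Q) (ι E) (ι z))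
    (sym (trans (ι-* (z ℕ.* Q) E) (cong (ℚ._* ι E) (ι-* z Q))))

  bounds : ∀ i →
    ∃[ z ] ((z ℕ.* Q ℕ.+ P) ℕ.* E ℕ.≤ Q ℕ.* (x ℕ.* v (toℕ i)) × Q ℕ.* (x ℕ.* v (toℕ i)) ℕ.+ P ℕ.* E ℕ.≤ suc z ℕ.* Q ℕ.* E) →
    ∃[ z ] (ι z ℚ.+ δ ℚ.≤ τ ℚ.* u i × τ ℚ.* u i ℚ.+ δ ℚ.≤ ι (suc z))
  bounds i (z , lower , upper) = z ,
    *-cancelˡ 0<QE (begin
      ι Q ℚ.* ι E ℚ.* (ι z ℚ.+ δ)                        ≡⟨ ℚ.*-distribˡ-+ (ι Q ℚ.* ι E) (ι z) δ ⟩
      ι Q ℚ.* ι E ℚ.* ι z ℚ.+ ι Q ℚ.* ι E ℚ.* δ          ≡⟨ cong₂ ℚ._+_ (QE*ι z) QE*δ ⟩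
      ι (z ℕ.* Q ℕ.* E) ℚ.+ ι (P ℕ.* E)                  ≡⟨ ι-+ (z ℕ.* Q ℕ.* E) (P ℕ.* E) ⟨
      ι (z ℕ.* Q ℕ.* E ℕ.+ P ℕ.* E)                      ≡⟨ cong ι (ℕ.*-distribʳ-+ E (z ℕ.* Q) P) ⟨
      ι ((z ℕ.* Q ℕ.+ P) ℕ.* E)                          ≤⟨ ι-mono-≤ lower ⟩
      ι (Q ℕ.* (x ℕ.* v (toℕ i)))                        ≡⟨ cong (λ a → ι (Q ℕ.* (x ℕ.* a))) (extend-toℕ A i) ⟩
      ι (Q ℕ.* (x ℕ.* A i))                              ≡⟨ QE*τu i ⟨
      ι Q ℚ.* ι E ℚ.* (τ ℚ.* u i)                        ∎) ,
    *-cancelˡ 0<QE (begin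
      ι Q ℚ.* ι E ℚ.* (τ ℚ.* u i ℚ.+ δ)                  ≡⟨ ℚ.*-distribˡ-+ (ι Q ℚ.* ι E) (τ ℚ.* u i) δ ⟩
      ι Q ℚ.* ι E ℚ.* (τ ℚ.* u i) ℚ.+ ι Q ℚ.* ι E ℚ.* δ  ≡⟨ cong₂ ℚ._+_ (QE*τu i) QE*δ ⟩
      ι (Q ℕ.* (x ℕ.* A i)) ℚ.+ ι (P ℕ.* E)              ≡⟨ ι-+ (Q ℕ.* (x ℕ.* A i)) (P ℕ.* E) ⟨
      ι (Q ℕ.* (x ℕ.* A i) ℕ.+ P ℕ.* E)                  ≡⟨ cong (λ a → ι (Q ℕ.* (x ℕ.* a) ℕ.+ P ℕ.* E)) (extend-toℕ A i) ⟨
      ι (Q ℕ.* (x ℕ.* v (toℕ i)) ℕ.+ P ℕ.* E)            ≤⟨ ι-mono-≤ upper ⟩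
      ι (suc z ℕ.* Q ℕ.* E)                              ≡⟨ QE*ι (suc z) ⟨
      ι Q ℚ.* ι E ℚ.* ι (suc z)                          ∎)
    where open ℚ.≤-Reasoning

-- Real speeds

Eventually : (ℕ → Set) → Set
Eventually Φ = ∃[ N ] ∀ m → N ℕ.≤ m → Φ m

eventually-× : ∀ {Φ Ψ : ℕ → Set} → Eventually Φ → Eventually Ψ → Eventually (λ m → Φ m × Ψ m)
eventually-× (M , φ) (N , ψ) = M ℕ.⊔ N , λ m le → φ m (ℕ.m⊔n≤o⇒m≤o M N le) , ψ m (ℕ.m⊔n≤o⇒n≤o M N le)

eventually-∀ : ∀ {n} {Φ : Fin n → ℕ → Set} → (∀ i → Eventually (Φ i)) → Eventually (λ m → ∀ i → Φ i m)
eventually-∀ {zero}  φ = 0 , λ _ _ ()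
eventually-∀ {suc n} φ with eventually-× (φ Fin.zero) (eventually-∀ (φ ∘ Fin.suc))
... | N , ψ = N , λ { m N≤m Fin.zero → proj₁ (ψ m N≤m) ; m N≤m (Fin.suc i) → proj₂ (ψ m N≤m) i }

-- The stage must be chosen before a proof of `A` is supplied, hence the decision.
eventually-→ : ∀ {A : Set} {Φ : ℕ → Set} → Dec A → (A → Eventually Φ) → Eventually (λ m → A → Φ m)
eventually-→ (yes a) φ = proj₁ (φ a) , λ m N≤m _ → proj₂ (φ a) m N≤m
eventually-→ (no ¬a) φ = 0 , λ m _ a → contradiction a ¬a

p≤∣p∣ : ∀ p → p ℚ.≤ ∣ p ∣
p≤∣p∣ p with ℚ.≤-total 0ℚ p
... | inj₁ 0≤p = ℚ.≤-reflexive (sym (ℚ.0≤p⇒∣p∣≡p 0≤p))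
... | inj₂ p≤0 = ℚ.≤-trans p≤0 (ℚ.0≤∣p∣ p)

∣p-q∣-comm : ∀ p q → ∣ p ℚ.- q ∣ ≡ ∣ q ℚ.- p ∣
∣p-q∣-comm p q = trans (sym (ℚ.∣-p∣≡∣p∣ (p ℚ.- q))) (cong ∣_∣ (solve 2 (λ p q → :- (p :- q) := q :- p) refl p q))
  where open ℚ-Solver

∣p-q∣<ε⇒p≤q+ε : ∀ p q {ε} → ∣ p ℚ.- q ∣ ℚ.< ε → p ℚ.≤ q ℚ.+ ε
∣p-q∣<ε⇒p≤q+ε p q {ε} d = subst (ℚ._≤ q ℚ.+ ε) (solve 2 (λ p q → q :+ (p :- q) := p) refl p q)
  (ℚ.+-monoʳ-≤ q (ℚ.≤-trans (p≤∣p∣ (p ℚ.- q)) (ℚ.<⇒≤ d)))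
  where open ℚ-Solver

∣p-q∣<ε⇒q≤p+ε : ∀ p q {ε} → ∣ p ℚ.- q ∣ ℚ.< ε → q ℚ.≤ p ℚ.+ ε
∣p-q∣<ε⇒q≤p+ε p q {ε} d = ∣p-q∣<ε⇒p≤q+ε q p (subst (ℚ._< ε) (∣p-q∣-comm p q) d)

p+q≤r⇒q≤r-p : ∀ p q r → p ℚ.+ q ℚ.≤ r → q ℚ.≤ r ℚ.- p
p+q≤r⇒q≤r-p p q r le = subst (ℚ._≤ r ℚ.- p) (solve 2 (λ p q → p :+ q :- p := q) refl p q) (ℚ.+-monoˡ-≤ (ℚ.- p) le)
  where open ℚ-Solver

-- Every integer is at most `z` or at least `z + 1`, and `x` is at least `y` away from both.
distℚ-≥ : ∀ z x y → ι z ℚ.+ y ℚ.≤ x → x ℚ.+ y ℚ.≤ ι (suc z) → y ℚ.≤ distℚ x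
distℚ-≥ z x y z+y≤x x+y≤1+z with distℚ-attained x
... | k , eq = subst (y ℚ.≤_) (sym eq) far
  where
  far : y ℚ.≤ ∣ x ℚ.- fromℤ k ∣
  far with k ℤ.≤? + z
  ... | yes k≤z = ℚ.≤-trans (p+q≤r⇒q≤r-p (fromℤ k) y x (ℚ.≤-trans (ℚ.+-monoˡ-≤ y (fromℤ-mono-≤ k≤z)) z+y≤x)) (p≤∣p∣ _)
  ... | no k≰z = subst (y ℚ.≤_) (∣p-q∣-comm (fromℤ k) x)
    (ℚ.≤-trans (p+q≤r⇒q≤r-p x y (fromℤ k) (ℚ.≤-trans x+y≤1+z (fromℤ-mono-≤ (ℤ.i<j⇒suc[i]≤j (ℤ.≰⇒> k≰z))))) (p≤∣p∣ _))

minimum-≥ : ∀ {n} .{{_ : NonZero n}} (f : Fin n → ℝ) m q → (∀ i → q ℚ.≤ seq (f i) m) → q ℚ.≤ seq (minimum f) m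
minimum-≥ {suc zero}    f m q q≤f = q≤f Fin.zero
minimum-≥ {suc (suc n)} f m q q≤f = ℚ.⊓-glb (q≤f Fin.zero) (minimum-≥ (f ∘ Fin.suc) m q (q≤f ∘ Fin.suc))

invℚ-cancel : ∀ {g} p → 0ℚ ℚ.< g → g ℚ.* (p ℚ.* invℚ g) ≡ p
invℚ-cancel {g} p 0<g = trans (solve 3 (λ g p i → g :* (p :* i) := (i :* g) :* p) refl g p (invℚ g))
  (trans (cong (ℚ._* p) (invℚ-inverse 0<g)) (ℚ.*-identityˡ p))
  where open ℚ-Solver

bound-by-ℕ : ∀ p → ∃[ B ] p ℚ.≤ ι B
bound-by-ℕ (mkℚ (+ a) d _) = a , *≤* (subst₂ ℤ._≤_ (sym (ℤ.*-identityʳ (+ a))) (ℤ.pos-* a (suc d)) (ℤ.+≤+ (ℕ.m≤m*n a (suc d))))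
bound-by-ℕ (mkℚ -[1+ a ] d _) = 0 , *≤* (ℤ.-≤+ )

shift-≥ : ∀ B n c → B ℕ.+ ℤ.∣ c ∣ ℕ.≤ n → + B ℤ.≤ + n ℤ.+ c
shift-≥ B n (+ k)    le = ℤ.+≤+ (ℕ.≤-trans (ℕ.m≤m+n B k) (ℕ.≤-trans le (ℕ.m≤m+n n k)))
shift-≥ B n -[1+ k ] le = subst (+ B ℤ.≤_) (sym (ℤ.⊖-≥ (ℕ.≤-trans (ℕ.m≤n+m (suc k) B) le)))
  (ℤ.+≤+ (ℕ.m+n≤o⇒m≤o∸n B le))

-- Quantitative estimates for e, the floor, the gap and perturbed speeds

recip!-nonNeg : ∀ k → 0ℚ ℚ.≤ recip! k
recip!-nonNeg k = ℚ.nonNegative⁻¹ (recip! k) {{ℚ.normalize-nonNeg 1 (k ℕ.!) {{k ℕ.!≢0}}}}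

expSum-≥ : ∀ j n → expSum n ℚ.≤ expSum (j ℕ.+ n)
expSum-≥ zero    n = ℚ.≤-refl
expSum-≥ (suc j) n = ℚ.≤-trans (expSum-≥ j n)
  (subst (ℚ._≤ expSum (suc j ℕ.+ n)) (ℚ.+-identityʳ _) (ℚ.+-monoʳ-≤ (expSum (j ℕ.+ n)) (recip!-nonNeg (j ℕ.+ n))))

-- `65/24` is the partial sum `1 + 1 + 1/2 + 1/6 + 1/24`.
65/24≤e : ∀ m → 5 ℕ.≤ m → (+ 65 ℚ./ 24) ℚ.≤ expSum m
65/24≤e m 5≤m = subst (λ k → (+ 65 ℚ./ 24) ℚ.≤ expSum k) (ℕ.m∸n+n≡m 5≤m) (expSum-≥ (m ℕ.∸ 5) 5)

-- The slack that makes this work is 32 · 403/400 ≤ 12 · 65/24 · 199/200.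
floor-bound : ∀ (h : ℕ) L A E a → 0ℚ ℚ.< L → 0ℚ ℚ.< A → (+ 65 ℚ./ 24) ℚ.≤ E →
  ι h ℚ.≤ L ℚ.* invℚ (ι 12 ℚ.* E ℚ.* A) ℚ.+ (+ 1 ℚ./ 200) → a ℚ.* ι 400 ℚ.≤ A ℚ.* ι 403 →
  ι h ℚ.* a ℚ.* ι 32 ℚ.≤ L
floor-bound zero L A E a 0<L _ _ _ _ = ℚ.≤-trans
  (ℚ.≤-reflexive (solve 1 (λ a → con 0ℚ :* a :* con (ι 32) := con 0ℚ) refl a)) (ℚ.<⇒≤ 0<L)
  where open ℚ-Solver
floor-bound h@(suc _) L A E a 0<L 0<A E≥ H≤ a≤ = *-cancelˡ (ι-pos 400 (ℕ.s≤s ℕ.z≤n)) (begin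
  ι 400 ℚ.* (H ℚ.* a ℚ.* ι 32)
    ≡⟨ solve 2 (λ H a → con (ι 400) :* (H :* a :* con (ι 32)) := H :* con (ι 32) :* (a :* con (ι 400))) refl H a ⟩
  H ℚ.* ι 32 ℚ.* (a ℚ.* ι 400)
    ≤⟨ *-monoˡ (*-nonNegative (ι-nonNeg h) (ι-nonNeg 32)) a≤ ⟩
  H ℚ.* ι 32 ℚ.* (A ℚ.* ι 403)
    ≡⟨ solve 2 (λ H A → H :* con (ι 32) :* (A :* con (ι 403)) := A :* H :* con (ι 12896)) refl H A ⟩
  A ℚ.* H ℚ.* ι 12896
    -- `12896 = 32 * 403`, while `12935 = 12 * 65/24 * 398`.
    ≤⟨ *-monoˡ (*-nonNegative (ℚ.<⇒≤ 0<A) (ι-nonNeg h)) (ι-mono-≤ (ℕ.≤ᵇ⇒≤ 12896 12935 _)) ⟩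
  A ℚ.* H ℚ.* ι 12935
    ≡⟨ solve 2 (λ H A → A :* H :* con (ι 12935) := con (ι 12) :* con (+ 65 ℚ./ 24) :* A :* H :* con (ι 398)) refl H A ⟩
  ι 12 ℚ.* (+ 65 ℚ./ 24) ℚ.* A ℚ.* H ℚ.* ι 398
    ≤⟨ *-monoʳ (ι-nonNeg 398) (*-monoʳ (ι-nonNeg h) (*-monoʳ (ℚ.<⇒≤ 0<A) (*-monoˡ (ι-nonNeg 12) E≥))) ⟩
  g ℚ.* H ℚ.* ι 398
    ≡⟨ solve 2 (λ g H → g :* H :* con (ι 398) := con (ι 400) :* (g :* H) :- con (ι 2) :* (g :* H)) refl g H ⟩
  ι 400 ℚ.* (g ℚ.* H) ℚ.- ι 2 ℚ.* (g ℚ.* H)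
    ≤⟨ ℚ.+-monoˡ-≤ (ℚ.- (ι 2 ℚ.* (g ℚ.* H))) (*-monoˡ (ι-nonNeg 400) gH≤) ⟩
  ι 400 ℚ.* (L ℚ.+ g ℚ.* H ℚ.* (+ 1 ℚ./ 200)) ℚ.- ι 2 ℚ.* (g ℚ.* H)
    ≡⟨ solve 3 (λ g H L → con (ι 400) :* (L :+ g :* H :* con (+ 1 ℚ./ 200)) :- con (ι 2) :* (g :* H) := con (ι 400) :* L) refl g H L ⟩
  ι 400 ℚ.* L ∎)
  where
  open ℚ-Solver
  open ℚ.≤-Reasoning
  H = ι h
  g = ι 12 ℚ.* E ℚ.* A
  0<E : 0ℚ ℚ.< E
  0<E = ℚ.<-≤-trans (ℚ.positive⁻¹ (+ 65 ℚ./ 24)) E≥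
  0<g : 0ℚ ℚ.< g
  0<g = *-positive (*-positive (ι-pos 12 (ℕ.s≤s ℕ.z≤n)) 0<E) 0<A
  -- Since `h ≥ 1`, the additive error `1/200` becomes the relative error `g * H / 200`; this is why
  -- `h = 0` is a separate case.
  gH≤ : g ℚ.* H ℚ.≤ L ℚ.+ g ℚ.* H ℚ.* (+ 1 ℚ./ 200)
  gH≤ = begin
    g ℚ.* H ≤⟨ *-monoˡ (ℚ.<⇒≤ 0<g) H≤ ⟩
    g ℚ.* (L ℚ.* invℚ g ℚ.+ (+ 1 ℚ./ 200)) ≡⟨ ℚ.*-distribˡ-+ g (L ℚ.* invℚ g) (+ 1 ℚ./ 200) ⟩
    g ℚ.* (L ℚ.* invℚ g) ℚ.+ g ℚ.* (+ 1 ℚ./ 200) ≡⟨ cong₂ ℚ._+_ (invℚ-cancel L 0<g) (cong (ℚ._* (+ 1 ℚ./ 200)) (sym (ℚ.*-identityʳ g))) ⟩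
    L ℚ.+ g ℚ.* 1ℚ ℚ.* (+ 1 ℚ./ 200)
      ≤⟨ ℚ.+-monoʳ-≤ L (*-monoʳ (ℚ.nonNegative⁻¹ (+ 1 ℚ./ 200)) (*-monoˡ (ℚ.<⇒≤ 0<g) (ι-mono-≤ {1} {h} (ℕ.s≤s ℕ.z≤n)))) ⟩
    L ℚ.+ g ℚ.* H ℚ.* (+ 1 ℚ./ 200) ∎

-- At a single term of the sequences the gap holds only up to an error. The error `η * lb / a`,
-- multiplied by `A ≤ a`, is at most `η * lb ≤ η * y`, which the slack `A + η ≤ a` absorbs.
gap-bound : ∀ L A a η lb x y → 0ℚ ℚ.< L → 0ℚ ℚ.< A → 0ℚ ℚ.< a → 0ℚ ℚ.< η → 0ℚ ℚ.< lb → lb ℚ.≤ y →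
  A ℚ.+ η ℚ.≤ a → L ℚ.* invℚ A ℚ.* x ℚ.≤ y ℚ.+ η ℚ.* lb ℚ.* invℚ a →
  x ℚ.≤ a ℚ.* invℚ L ℚ.* y
gap-bound L A a η lb x y 0<L 0<A 0<a 0<η 0<lb lb≤y A+η≤a wx≤ = *-cancelˡ 0<L (begin
  L ℚ.* x                                   ≡⟨ cong (ℚ._* x) (sym (invℚ-cancel L 0<A)) ⟩
  A ℚ.* (L ℚ.* invℚ A) ℚ.* x                ≡⟨ ℚ.*-assoc A (L ℚ.* invℚ A) x ⟩
  A ℚ.* (L ℚ.* invℚ A ℚ.* x)                ≤⟨ *-monoˡ (ℚ.<⇒≤ 0<A) wx≤ ⟩
  A ℚ.* (y ℚ.+ ε)                           ≡⟨ ℚ.*-distribˡ-+ A y ε ⟩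
  A ℚ.* y ℚ.+ A ℚ.* ε                       ≤⟨ ℚ.+-monoʳ-≤ (A ℚ.* y) (*-monoʳ (ℚ.<⇒≤ 0<ε) A≤a) ⟩
  A ℚ.* y ℚ.+ a ℚ.* ε                       ≡⟨ cong (A ℚ.* y ℚ.+_) (invℚ-cancel (η ℚ.* lb) 0<a) ⟩
  A ℚ.* y ℚ.+ η ℚ.* lb                      ≤⟨ ℚ.+-monoʳ-≤ (A ℚ.* y) (*-monoˡ (ℚ.<⇒≤ 0<η) lb≤y) ⟩
  A ℚ.* y ℚ.+ η ℚ.* y                       ≡⟨ ℚ.*-distribʳ-+ y A η ⟨
  (A ℚ.+ η) ℚ.* y                           ≤⟨ *-monoʳ (ℚ.<⇒≤ (ℚ.<-≤-trans 0<lb lb≤y)) A+η≤a ⟩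
  a ℚ.* y                                   ≡⟨ cong (ℚ._* y) (sym (invℚ-cancel a 0<L)) ⟩
  L ℚ.* (a ℚ.* invℚ L) ℚ.* y                ≡⟨ ℚ.*-assoc L (a ℚ.* invℚ L) y ⟩
  L ℚ.* (a ℚ.* invℚ L ℚ.* y)                ∎)
  where
  open ℚ.≤-Reasoning
  ε = η ℚ.* lb ℚ.* invℚ a
  0<ε : 0ℚ ℚ.< ε
  0<ε = *-positive (*-positive 0<η 0<lb) (invℚ-pos 0<a)
  A≤a : A ℚ.≤ a
  A≤a = ℚ.≤-trans (subst (ℚ._≤ A ℚ.+ η) (ℚ.+-identityʳ A) (ℚ.+-monoʳ-≤ A (ℚ.<⇒≤ 0<η))) A+η≤a

-- Since `τ * lb ≤ τ * u₀ ≤ 1`, an error of `lb * ε` in the speed displaces the runner at time `τ`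
-- by at most `ε`.
perturb : ∀ z δ ε τ lb u u₀ x → 0ℚ ℚ.≤ ε → 0ℚ ℚ.≤ τ → lb ℚ.≤ u₀ → τ ℚ.* u₀ ℚ.≤ 1ℚ →
  x ℚ.≤ u ℚ.+ lb ℚ.* ε → u ℚ.≤ x ℚ.+ lb ℚ.* ε →
  ι z ℚ.+ δ ℚ.≤ τ ℚ.* u → τ ℚ.* u ℚ.+ δ ℚ.≤ ι (suc z) →
  δ ℚ.- ε ℚ.≤ distℚ (τ ℚ.* x)
perturb z δ ε τ lb u u₀ x 0≤ε 0≤τ lb≤u₀ τu₀≤1 x≤ u≤ lower upper = distℚ-≥ z (τ ℚ.* x) (δ ℚ.- ε)
  (begin
    ι z ℚ.+ (δ ℚ.- ε)         ≡⟨ ℚ.+-assoc (ι z) δ (ℚ.- ε) ⟨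
    ι z ℚ.+ δ ℚ.- ε           ≤⟨ ℚ.+-monoˡ-≤ (ℚ.- ε) (ℚ.≤-trans lower (move u≤)) ⟩
    τ ℚ.* x ℚ.+ ε ℚ.- ε       ≡⟨ solve 2 (λ t e → t :+ e :- e := t) refl (τ ℚ.* x) ε ⟩
    τ ℚ.* x                   ∎)
  (begin
    τ ℚ.* x ℚ.+ (δ ℚ.- ε)             ≤⟨ ℚ.+-monoˡ-≤ (δ ℚ.- ε) (move x≤) ⟩
    τ ℚ.* u ℚ.+ ε ℚ.+ (δ ℚ.- ε)       ≡⟨ solve 3 (λ t e d → t :+ e :+ (d :- e) := t :+ d) refl (τ ℚ.* u) ε δ ⟩
    τ ℚ.* u ℚ.+ δ                     ≤⟨ upper ⟩
    ι (suc z)                         ∎)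
  where
  open ℚ-Solver
  open ℚ.≤-Reasoning
  move : ∀ {p q} → p ℚ.≤ q ℚ.+ lb ℚ.* ε → τ ℚ.* p ℚ.≤ τ ℚ.* q ℚ.+ ε
  move {p} {q} p≤ = begin
    τ ℚ.* p                             ≤⟨ *-monoˡ 0≤τ p≤ ⟩
    τ ℚ.* (q ℚ.+ lb ℚ.* ε)              ≡⟨ solve 4 (λ t q l e → t :* (q :+ l :* e) := t :* q :+ t :* l :* e) refl τ q lb ε ⟩
    τ ℚ.* q ℚ.+ τ ℚ.* lb ℚ.* ε          ≤⟨ ℚ.+-monoʳ-≤ (τ ℚ.* q) (*-monoʳ 0≤ε (ℚ.≤-trans (*-monoˡ 0≤τ lb≤u₀) τu₀≤1)) ⟩
    τ ℚ.* q ℚ.+ 1ℚ ℚ.* ε                ≡⟨ cong (τ ℚ.* q ℚ.+_) (ℚ.*-identityˡ ε) ⟩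
    τ ℚ.* q ℚ.+ ε                       ∎

-- Terms beyond `N₀` are within `η` of the `N₀`-th, so adding `2η` to it overshoots them by between
-- `η` and `3η`. As `η` is `1/400` of a lower bound for `α`, the overshoot is at most `3/400` of any
-- late term.
over-approximation : ∀ α → 0ℝ < α → ∃[ a ] ∃[ η ] (0ℚ ℚ.< a × 0ℚ ℚ.< η ×
  Eventually (λ m → 0ℚ ℚ.< seq α m × seq α m ℚ.+ η ℚ.≤ a × a ℚ.* ι 400 ℚ.≤ seq α m ℚ.* ι 403))
over-approximation α (a₀ , 0<a₀ , M , a₀≤α) = a , η , 0<a , 0<η , N , λ m N≤m →
  0<α m (ℕ.m⊔n≤o⇒m≤o M N₀ N≤m) , α+η≤a m (ℕ.m⊔n≤o⇒n≤o M N₀ N≤m) , (begin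
    a ℚ.* ι 400
      ≡⟨ solve 2 (λ x e → (x :+ (e :+ e)) :* con (ι 400) := x :* con (ι 400) :+ e :* con (ι 800)) refl (seq α N₀) η ⟩
    seq α N₀ ℚ.* ι 400 ℚ.+ η ℚ.* ι 800
      ≤⟨ ℚ.+-monoˡ-≤ (η ℚ.* ι 800) (*-monoʳ (ι-nonNeg 400) (∣p-q∣<ε⇒q≤p+ε (seq α m) (seq α N₀) (near m (ℕ.m⊔n≤o⇒n≤o M N₀ N≤m)))) ⟩
    (seq α m ℚ.+ η) ℚ.* ι 400 ℚ.+ η ℚ.* ι 800
      ≡⟨ solve 2 (λ x b → (x :+ b :* con (+ 1 ℚ./ 400)) :* con (ι 400) :+ b :* con (+ 1 ℚ./ 400) :* con (ι 800) := x :* con (ι 400) :+ b :* con (ι 3)) refl (seq α m) a₀ ⟩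
    seq α m ℚ.* ι 400 ℚ.+ a₀ ℚ.* ι 3
      ≤⟨ ℚ.+-monoʳ-≤ (seq α m ℚ.* ι 400) (*-monoʳ (ι-nonNeg 3) (a₀≤ m (ℕ.m⊔n≤o⇒m≤o M N₀ N≤m))) ⟩
    seq α m ℚ.* ι 400 ℚ.+ seq α m ℚ.* ι 3
      ≡⟨ solve 1 (λ x → x :* con (ι 400) :+ x :* con (ι 3) := x :* con (ι 403)) refl (seq α m) ⟩
    seq α m ℚ.* ι 403 ∎)
  where
  open ℚ-Solver
  open ℚ.≤-Reasoning
  η = a₀ ℚ.* (+ 1 ℚ./ 400)
  0<η : 0ℚ ℚ.< η
  0<η = *-positive 0<a₀ (ℚ.positive⁻¹ (+ 1 ℚ./ 400))
  N₀ = proj₁ (cauchy α η 0<η)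
  N = M ℕ.⊔ N₀
  near : ∀ m → N₀ ℕ.≤ m → ∣ seq α m ℚ.- seq α N₀ ∣ ℚ.< η
  near m N₀≤m = proj₂ (cauchy α η 0<η) m N₀ N₀≤m ℕ.≤-refl
  a = seq α N₀ ℚ.+ (η ℚ.+ η)
  a₀≤ : ∀ m → M ℕ.≤ m → a₀ ℚ.≤ seq α m
  a₀≤ m M≤m = subst (ℚ._≤ seq α m) (ℚ.+-identityˡ a₀) (a₀≤α m M≤m)
  0<α : ∀ m → M ℕ.≤ m → 0ℚ ℚ.< seq α m
  0<α m M≤m = ℚ.<-≤-trans 0<a₀ (a₀≤ m M≤m)
  α+η≤a : ∀ m → N₀ ℕ.≤ m → seq α m ℚ.+ η ℚ.≤ a
  α+η≤a m N₀≤m = ℚ.≤-trans (ℚ.+-monoˡ-≤ η (∣p-q∣<ε⇒p≤q+ε (seq α m) (seq α N₀) (near m N₀≤m))) (ℚ.≤-reflexive (ℚ.+-assoc (seq α N₀) η η))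
  0<a : 0ℚ ℚ.< a
  0<a = ℚ.<-≤-trans (0<α N (ℕ.m≤m⊔n M N₀))
    (ℚ.≤-trans (subst (ℚ._≤ seq α N ℚ.+ η) (ℚ.+-identityʳ (seq α N)) (ℚ.+-monoʳ-≤ (seq α N) (ℚ.<⇒≤ 0<η)))
      (α+η≤a N (ℕ.m≤n⊔m M N₀)))

-- From one Cauchy term to a lonely time for the real speeds

module LonelyTime (α : ℝ) (α>0 : 0ℝ < α) (a η : ℚ) (0<a : 0ℚ ℚ.< a) (0<η : 0ℚ ℚ.< η)
  (α≈a : Eventually (λ m → 0ℚ ℚ.< seq α m × seq α m ℚ.+ η ℚ.≤ a × a ℚ.* ι 400 ℚ.≤ seq α m ℚ.* ι 403))
  (n : ℕ) (k : ℤ) (k>0 : + 0 ℤ.< k) (a≤k : a ℚ.* ι 10240 ℚ.≤ fromℤ k)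
  (h : ℕ) (h≤ : fromInt (+ h) ≤ fromInt k / (fromInt (+ 12) * e * α) [ 12eα>0 α α>0 ])
  (v : Fin (suc n) → ℝ) (v>0 : 0ℝ < v Fin.zero)
  (v-mono : ∀ i j → i Fin.< j → v i < v j)
  (v-gap : ∀ i j → toℕ j ≡ toℕ i ℕ.+ h → (fromInt k / α [ α>0 ]) * v i ≤ v j) where

  open ℚ-Solver

  -- `δ` exceeds `α / k` by at least `η / k = 2ε`: one `ε` pays for approximating the speeds, the
  -- other makes the final inequality strict. Speeds may vary by `κ`, which up to time `1/lb` moves
  -- a runner by at most `ε`.
  L I δ ε lb κ : ℚ
  L = fromℤ k
  I = invℚ L
  δ = a ℚ.* I
  ε = ½ ℚ.* (η ℚ.* I)
  lb = proj₁ v>0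
  κ = lb ℚ.* ε

  0<L : 0ℚ ℚ.< L
  0<L = ℚ.<-≤-trans (ℚ.positive⁻¹ 1ℚ) (fromℤ-mono-≤ (ℤ.i<j⇒suc[i]≤j k>0))

  0<I : 0ℚ ℚ.< I
  0<I = invℚ-pos 0<L

  0<δ : 0ℚ ℚ.< δ
  0<δ = *-positive 0<a 0<I

  0<ε : 0ℚ ℚ.< ε
  0<ε = *-positive (ℚ.positive⁻¹ ½) (*-positive 0<η 0<I)

  0<lb : 0ℚ ℚ.< lb
  0<lb = proj₁ (proj₂ v>0)

  0<κ : 0ℚ ℚ.< κ
  0<κ = *-positive 0<lb 0<ε

  gap-error : ℚ
  gap-error = η ℚ.* lb ℚ.* invℚ a

  0<gap-error : 0ℚ ℚ.< gap-error
  0<gap-error = *-positive (*-positive 0<η 0<lb) (invℚ-pos 0<a)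

  lb≤v₀ : Eventually (λ m → lb ℚ.≤ seq (v Fin.zero) m)
  lb≤v₀ = proj₁ (proj₂ (proj₂ v>0)) , λ m le →
    subst (ℚ._≤ seq (v Fin.zero) m) (ℚ.+-identityˡ lb) (proj₂ (proj₂ (proj₂ v>0)) m le)

  increasing : Eventually (λ m → ∀ i j → i Fin.< j → seq (v i) m ℚ.≤ seq (v j) m)
  increasing = eventually-∀ λ i → eventually-∀ λ j → eventually-→ (i Fin.<? j) λ i<j →
    let r , 0<r , N , le = v-mono i j i<j in
    N , λ m N≤m → ℚ.≤-trans
      (subst (ℚ._≤ seq (v i) m ℚ.+ r) (ℚ.+-identityʳ (seq (v i) m)) (ℚ.+-monoʳ-≤ (seq (v i) m) (ℚ.<⇒≤ 0<r)))
      (le m N≤m)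

  spread : Eventually (λ m → ∀ i j → toℕ j ≡ toℕ i ℕ.+ h →
    L ℚ.* invℚ (seq α m) ℚ.* seq (v i) m ℚ.≤ seq (v j) m ℚ.+ gap-error)
  spread = eventually-∀ λ i → eventually-∀ λ j → eventually-→ (toℕ j ℕ.≟ toℕ i ℕ.+ h) λ eq →
    v-gap i j eq gap-error 0<gap-error

  -- All later terms are controlled at once, because the time computed from the `m`-th terms must
  -- serve for every later one.
  settled : Eventually (λ m → ∀ i m′ → m ℕ.≤ m′ → ∣ seq (v i) m′ ℚ.- seq (v i) m ∣ ℚ.< κ)
  settled = eventually-∀ λ i → let N , near = cauchy (v i) κ 0<κ in
    N , λ m N≤m m′ m≤m′ → near m′ m (ℕ.≤-trans N≤m m≤m′) N≤m

  floored : Eventually (λ m → ι h ℚ.≤ L ℚ.* invℚ (ι 12 ℚ.* expSum m ℚ.* seq α m) ℚ.+ (+ 1 ℚ./ 200))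
  floored = h≤ (+ 1 ℚ./ 200) (ℚ.positive⁻¹ (+ 1 ℚ./ 200))

  record Accurate (m : ℕ) : Set where
    constructor accurate
    field
      approx     : 0ℚ ℚ.< seq α m × seq α m ℚ.+ η ℚ.≤ a × a ℚ.* ι 400 ℚ.≤ seq α m ℚ.* ι 403
      lb≤u₀      : lb ℚ.≤ seq (v Fin.zero) m
      u-mono     : ∀ i j → i Fin.< j → seq (v i) m ℚ.≤ seq (v j) m
      u-spread   : ∀ i j → toℕ j ≡ toℕ i ℕ.+ h →
                   L ℚ.* invℚ (seq α m) ℚ.* seq (v i) m ℚ.≤ seq (v j) m ℚ.+ gap-error
      u-settled  : ∀ i m′ → m ℕ.≤ m′ → ∣ seq (v i) m′ ℚ.- seq (v i) m ∣ ℚ.< κ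
      u-floored  : ι h ℚ.≤ L ℚ.* invℚ (ι 12 ℚ.* expSum m ℚ.* seq α m) ℚ.+ (+ 1 ℚ./ 200)
      e-accurate : 5 ℕ.≤ m

  eventually-accurate : Eventually Accurate
  eventually-accurate =
    let N , all = eventually-× α≈a (eventually-× lb≤v₀ (eventually-× increasing
                    (eventually-× spread (eventually-× settled (eventually-× floored (5 , λ m 5≤m → 5≤m))))))
    in N , λ m N≤m → let p₁ , p₂ , p₃ , p₄ , p₅ , p₆ , p₇ = all m N≤m in accurate p₁ p₂ p₃ p₄ p₅ p₆ p₇

  module Stage (m : ℕ) (acc : Accurate m) where
    open Accurate acc public

    0<α : 0ℚ ℚ.< seq α m
    0<α = proj₁ approx

    u : Fin (suc n) → ℚ
    u i = seq (v i) m

    u-mono-≤ : ∀ i j → toℕ i ℕ.≤ toℕ j → u i ℚ.≤ u j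
    u-mono-≤ i j i≤j with ℕ.m≤n⇒m<n∨m≡n i≤j
    ... | inj₁ i<j = u-mono i j i<j
    ... | inj₂ i≡j = ℚ.≤-reflexive (cong u (Fin.toℕ-injective i≡j))

    lb≤u : ∀ i → lb ℚ.≤ u i
    lb≤u i = ℚ.≤-trans lb≤u₀ (u-mono-≤ Fin.zero i ℕ.z≤n)

    -- The spread is known at index distance exactly `h`; the order of the speeds extends it to
    -- larger distances.
    u-gap : ∀ i j → toℕ i ℕ.+ h ℕ.≤ toℕ j → u i ℚ.≤ δ ℚ.* u j
    u-gap i j i+h≤j = ℚ.≤-trans
      (gap-bound L (seq α m) a η lb (u i) (u j′) 0<L 0<α 0<a 0<η 0<lb (lb≤u j′) (proj₁ (proj₂ approx))
        (u-spread i j′ (Fin.toℕ-fromℕ< i+h<n)))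
      (*-monoˡ (ℚ.<⇒≤ 0<δ) (u-mono-≤ j′ j (subst (ℕ._≤ toℕ j) (sym (Fin.toℕ-fromℕ< i+h<n)) i+h≤j)))
      where
      i+h<n : toℕ i ℕ.+ h ℕ.< suc n
      i+h<n = ℕ.≤-<-trans i+h≤j (Fin.toℕ<n j)
      j′ = fromℕ< i+h<n

    δ-small : δ ℚ.* ι 10240 ℚ.≤ 1ℚ
    δ-small = *-cancelˡ 0<L (subst₂ ℚ._≤_
      (trans (cong (ℚ._* ι 10240) (sym (invℚ-cancel a 0<L))) (ℚ.*-assoc L δ (ι 10240)))
      (sym (ℚ.*-identityʳ L)) a≤k)

    hδ-small : ι h ℚ.* δ ℚ.* ι 32 ℚ.≤ 1ℚ
    hδ-small = *-cancelˡ 0<L (subst₂ ℚ._≤_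
      (trans (cong (λ x → ι h ℚ.* x ℚ.* ι 32) (sym (invℚ-cancel a 0<L)))
        (solve 4 (λ h l d c → h :* (l :* d) :* c := l :* (h :* d :* c)) refl (ι h) L δ (ι 32)))
      (sym (ℚ.*-identityʳ L))
      (floor-bound h L (seq α m) (expSum m) a 0<L 0<α (65/24≤e m e-accurate) u-floored (proj₂ (proj₂ approx))))

    rational-solution : ∃[ τ ] (0ℚ ℚ.≤ τ × τ ℚ.* u Fin.zero ℚ.≤ 1ℚ ×
      ∀ i → ∃[ z ] (ι z ℚ.+ δ ℚ.≤ τ ℚ.* u i × τ ℚ.* u i ℚ.+ δ ℚ.≤ ι (suc z)))
    rational-solution = rational-lonely-time n h δ u 0<δ (λ i → ℚ.<-≤-trans 0<lb (lb≤u i))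
      δ-small hδ-small (λ i → u-mono-≤ Fin.zero i ℕ.z≤n) u-gap

  α/k+ε≤ : ∀ x → x ℚ.+ η ℚ.≤ a → x ℚ.* I ℚ.+ ε ℚ.≤ δ ℚ.- ε
  α/k+ε≤ x x+η≤a = begin
    x ℚ.* I ℚ.+ ε               ≡⟨ solve 3 (λ x i e → x :* i :+ con ½ :* (e :* i) := (x :+ e) :* i :- con ½ :* (e :* i)) refl x I η ⟩
    (x ℚ.+ η) ℚ.* I ℚ.- ε       ≤⟨ ℚ.+-monoˡ-≤ (ℚ.- ε) (*-monoʳ (ℚ.<⇒≤ 0<I) x+η≤a) ⟩
    δ ℚ.- ε                     ∎
    where open ℚ.≤-Reasoning

  LonelyFrom : ℕ → ℚ → Set
  LonelyFrom N τ = ∀ m → N ℕ.≤ m → seq α m ℚ.* I ℚ.+ ε ℚ.≤ seq (minimum λ i → ‖ fromℚ τ * v i ‖) m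

  -- The time is found from the terms at stage `N` and is a constant rational, so only the drift of
  -- the speeds after `N` has to be accounted for.
  lonely-from : ∀ N → (∀ m → N ℕ.≤ m → Accurate m) → ∃[ τ ] LonelyFrom N τ
  lonely-from N acc = real-solution rational-solution
    where
    open Stage N (acc N ℕ.≤-refl)
    real-solution : ∃[ τ ] (0ℚ ℚ.≤ τ × τ ℚ.* u Fin.zero ℚ.≤ 1ℚ ×
      ∀ i → ∃[ z ] (ι z ℚ.+ δ ℚ.≤ τ ℚ.* u i × τ ℚ.* u i ℚ.+ δ ℚ.≤ ι (suc z))) → ∃[ τ ] LonelyFrom N τ
    real-solution (τ , 0≤τ , τu₀≤1 , separated) = τ , λ m N≤m → ℚ.≤-trans
      (α/k+ε≤ (seq α m) (proj₁ (proj₂ (Accurate.approx (acc m N≤m)))))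
      (minimum-≥ (λ i → ‖ fromℚ τ * v i ‖) m (δ ℚ.- ε) λ i →
        let z , lower , upper = separated i
            close = u-settled i m N≤m
        in perturb z δ ε τ lb (u i) (u Fin.zero) (seq (v i) m) (ℚ.<⇒≤ 0<ε) 0≤τ lb≤u₀ τu₀≤1
             (∣p-q∣<ε⇒p≤q+ε (seq (v i) m) (u i) close) (∣p-q∣<ε⇒q≤p+ε (seq (v i) m) (u i) close) lower upper)

  lonely : (k>0ℝ : 0ℝ < fromInt k) → α / fromInt k [ k>0ℝ ] <ˡ ML v
  lonely k>0ℝ = conclude (lonely-from (proj₁ eventually-accurate) (proj₂ eventually-accurate))
    where
    conclude : ∀ {N} → ∃[ τ ] LonelyFrom N τ → α / fromInt k [ k>0ℝ ] <ˡ ML v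
    conclude {N} (τ , ≤min) =
      <ˡ-sup⁺ (λ t → minimum λ i → ‖ t * v i ‖) (α / fromInt k [ k>0ℝ ]) (fromℚ τ) (ε , 0<ε , N , ≤min)

theorem12p7 :
    (c : ℤ) (α : ℝ) (α>0 : 0ℝ < α) →
    ∃[ N ] ∀ (n : ℕ) .{{_ : NonZero n}} → n ℕ.≥ N →
      (n+c>0 : + 0 ℤ.< + n ℤ.+ c) →
      let n+c = fromInt (+ n ℤ.+ c)
          w   = n+c / α [ α>0 ]
      in
      (h : ℕ) → IsFloor (+ h) (n+c / (fromInt (+ 12) * e * α) [ 12eα>0 α α>0 ]) →
      (v : Fin n → ℝ) →
      (∀ i → 0ℝ < v i) →
      (∀ i j → i Fin.< j → v i < v j) →
      (∀ i j → toℕ j ≡ toℕ i ℕ.+ h → w * v i ≤ v j) →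
      α / n+c [ fromInt-pos n+c>0 ] <ˡ ML v
theorem12p7 c α α>0 =
  let a , η , 0<a , 0<η , α≈a = over-approximation α α>0
      B , a≤B = bound-by-ℕ (a ℚ.* ι 10240)
  -- This threshold gives `n + c ≥ B ≥ 10240 a`, so `δ = a / (n + c)` is at most `1/10240`, as the
  -- rounding of `h` to a multiple of 4 demands.
  in B ℕ.+ ℤ.∣ c ∣ , λ where
    (suc n) n≥N n+c>0 h floor v v>0 v-mono v-gap → LonelyTime.lonely α α>0 a η 0<a 0<η α≈a
      n (+ suc n ℤ.+ c) n+c>0 (ℚ.≤-trans a≤B (fromℤ-mono-≤ (shift-≥ B (suc n) c n≥N)))
      h (proj₁ floor) v (v>0 Fin.zero) v-mono v-gap (fromInt-pos n+c>0)
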